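{- (a) A hereditary class $\mathcal C$ of finite posets of width at most two is minimal prime if and only if $\mathcal C=\mathrm{age}(P_1)$ or $\mathcal C=\mathrm{age}(P_2)$. (b) A hereditary class $\mathcal C$ of finite graphs, each of which is the incomparability graph of a poset of width at most two, is minimal prime if and only if $\mathcal C=\mathrm{age}(H)$ or $\mathcal C=\mathrm{age}(\mathrm P_\infty)$.
   Context: A module of a structure (poset or graph) on $V$ is a set $A\subseteq V$ such that each $v\notin A$ relates identically (below/above/incomparable, resp. adjacent/nonadjacent) to all elements of $A$; it is trivial if it is $\emptyset$, a singleton or $V$; a structure is prime if all its modules are trivial. A hereditary class of finite structures (closed under embeddability as induced substructures) is minimal prime if it contains infinitely many prime members while every proper hereditary subclass contains only finitely many. The age of a structure is the class of finite structures embeddable in it. $\mathrm P_\infty$ is the one-way infinite path. $H$ is the graph on disjoint independent sets $\{a_i:i\in\mathbb N\}$, $\{b_i:i\in\mathbb N\}$ with $\{a_i,b_j\}$ an edge iff $i\le j$. Let $\le$ be the natural order on $\mathbb N$; let $\le_{\omega+\omega}$ list the odd integers in natural order before all even integers in natural order; let $\sigma$ be the permutation of $\mathbb N$ with $\sigma(0)=1$, $\sigma(1)=3$, and for $n\ge1$, $\sigma(2n)=2n-2$, $\sigma(2n+1)=2n+3$, and $i\le_\omega j$ iff $\sigma(i)\le\sigma(j)$. Then $P_1:=(\mathbb N,\le\cap\le_{\omega+\omega})$ and $P_2:=(\mathbb N,\le\cap\le_\omega)$. -}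

module Defs where

open import Data.Nat using (ℕ; zero; suc; _+_; _≤_; _<_; _≤ᵇ_; _≡ᵇ_)
open import Data.Fin using (Fin; _≟_)
open import Data.Bool using (Bool; true; false; _∧_; _∨_; not; if_then_else_)
open import Data.Sum using (_⊎_; inj₁; inj₂)
open import Data.Product using (Σ; ∃; _×_; _,_)
open import Data.Empty using (⊥)
open import Relation.Nullary using (¬_)
open import Relation.Nullary.Decidable using (⌊_⌋)
open import Relation.Binary.PropositionalEquality using (_≡_)
open import Level using (0ℓ) renaming (suc to lsuc)

-- Finite binary structures: a vertex set Fin size with a (decidable,
-- Bool-valued) binary relation.  Posets use rel = ≤ ; graphs use
-- rel = adjacency.

record FinStr : Set where
  constructor mkStr
  field
    size : ℕ
    rel  : Fin size → Fin size → Bool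
open FinStr public

record IsPoset (P : FinStr) : Set where
  field
    refl′   : ∀ i → rel P i i ≡ true
    antisym : ∀ i j → rel P i j ≡ true → rel P j i ≡ true → i ≡ j
    trans′  : ∀ i j k → rel P i j ≡ true → rel P j k ≡ true → rel P i k ≡ true

record IsGraph (G : FinStr) : Set where
  field
    sym′  : ∀ i j → rel G i j ≡ rel G j i
    irrefl : ∀ i → rel G i i ≡ false

Incomp : (P : FinStr) → Fin (size P) → Fin (size P) → Set
Incomp P x y = (rel P x y ≡ false) × (rel P y x ≡ false)

Width≤2 : FinStr → Set
Width≤2 P = ∀ x y z → Incomp P x y → Incomp P y z → Incomp P x z → ⊥

IsIncompGraphW2 : FinStr → Set
IsIncompGraphW2 G =
  Σ (Fin (size G) → Fin (size G) → Bool) λ r →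
    IsPoset (mkStr (size G) r) × Width≤2 (mkStr (size G) r) ×
    (∀ i j → rel G i j ≡ (not ⌊ i ≟ j ⌋ ∧ not (r i j ∨ r j i)))

Injective : {A B : Set} → (A → B) → Set
Injective f = ∀ x y → f x ≡ f y → x ≡ y

Embeds : FinStr → FinStr → Set
Embeds Q P = Σ (Fin (size Q) → Fin (size P)) λ f →
  Injective f × (∀ i j → rel Q i j ≡ rel P (f i) (f j))

Class : Set₁
Class = FinStr → Set

Hereditary : Class → Set
Hereditary C = ∀ P Q → C P → Embeds Q P → C Q

_⊆C_ : Class → Class → Set
C ⊆C D = ∀ P → C P → D P

_≐_ : Class → Class → Set
C ≐ D = (C ⊆C D) × (D ⊆C C)

Age : {V : Set} → (V → V → Bool) → Class
Age {V} R P = Σ (Fin (size P) → V) λ f →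
  Injective f × (∀ i j → rel P i j ≡ R (f i) (f j))

IsModule : (S : FinStr) → (Fin (size S) → Bool) → Set
IsModule S A = ∀ v a a′ → A v ≡ false → A a ≡ true → A a′ ≡ true →
  (rel S v a ≡ rel S v a′) × (rel S a v ≡ rel S a′ v)

Trivial : (S : FinStr) → (Fin (size S) → Bool) → Set
Trivial S A = (∀ x y → A x ≡ true → A y ≡ true → x ≡ y) ⊎ (∀ x → A x ≡ true)

Prime : FinStr → Set
Prime S = ∀ A → IsModule S A → Trivial S A

-- C contains infinitely many prime members (up to isomorphism):
-- there are prime members of arbitrarily large size
InfManyPrimes : Class → Set
InfManyPrimes C = ∀ m → Σ FinStr λ P → C P × Prime P × (m ≤ size P)

FinManyPrimes : Class → Set
FinManyPrimes C = Σ ℕ λ m → ∀ P → C P → Prime P → size P < m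

MinimalPrime : Class → Set₁
MinimalPrime C = Hereditary C × InfManyPrimes C ×
  (∀ (D : Class) → Hereditary D → D ⊆C C → (Σ FinStr λ P → C P × ¬ D P) →
     FinManyPrimes D)

isEven : ℕ → Bool
isEven zero = true
isEven (suc n) = not (isEven n)

le-ωω : ℕ → ℕ → Bool
le-ωω i j with isEven i | isEven j
... | false | true  = true
... | true  | false = false
... | _     | _     = i ≤ᵇ j

-- σ(0)=1, σ(1)=3, σ(2n)=2n-2, σ(2n+1)=2n+3 (n ≥ 1)
σ : ℕ → ℕ
σ zero = 1
σ (suc zero) = 3
σ (suc (suc k)) = if isEven k then k else k + 4

le-ω : ℕ → ℕ → Bool
le-ω i j = σ i ≤ᵇ σ j

P₁ : ℕ → ℕ → Bool
P₁ i j = (i ≤ᵇ j) ∧ le-ωω i j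

P₂ : ℕ → ℕ → Bool
P₂ i j = (i ≤ᵇ j) ∧ le-ω i j

H : ℕ ⊎ ℕ → ℕ ⊎ ℕ → Bool
H (inj₁ i) (inj₂ j) = i ≤ᵇ j
H (inj₂ j) (inj₁ i) = i ≤ᵇ j
H (inj₁ _) (inj₁ _) = false
H (inj₂ _) (inj₂ _) = false

P∞ : ℕ → ℕ → Bool
P∞ i j = (suc i ≡ᵇ j) ∨ (suc j ≡ᵇ i)

PosetsW2 : Class → Set
PosetsW2 C = ∀ P → C P → IsPoset P × Width≤2 P

GraphsIncW2 : Class → Set
GraphsIncW2 C = ∀ G → C G → IsGraph G × IsIncompGraphW2 G

_⇔₁_ : Set₁ → Set → Set₁
A ⇔₁ B = (A → B) × (B → A)

{-# OPTIONS --safe #-}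
-- Both parts rest on one finite fact: a large prime poset of width at most two contains a large
-- initial segment of P₁ or of the path order (i below j iff i + 2 ≤ j), which is P₂ reindexed.
-- If some v is incomparable to many elements, these form a chain. No two consecutive members of the
-- chain form a module, so each such pair is separated by some w, which then splits the whole chain
-- at that place; half of these w lie on the same side of v and span a half graph with the chain.
-- If all incomparability degrees are bounded, the incomparability graph, being connected by
-- primality, has a long geodesic, and the order on a geodesic is forced up to reversal.
-- A prime incomparability graph comes from a prime poset, so the graph version follows.
-- Finally, if C is minimal prime and contains a member S of one family that embeds in no member of
-- the other, then the S-free part of C has bounded primes, so C contains the whole first family;
-- and for P in C the P-free part of C has bounded primes, so P embeds in that family.
-- This avoids any infinite pigeonhole argument and makes the proof constructive.

module Submission where

open import Defs
open import Data.Bool using (Bool; true; false; _∧_; _∨_; not; if_then_else_)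
import Data.Bool.Properties as Bool
open import Data.Empty using (⊥; ⊥-elim)
open import Data.Fin using (Fin; zero; suc; toℕ; fromℕ<; inject≤; #_; finToFun; funToFin; _≟_)
import Data.Fin.Properties as Fin
open import Data.List.Base using (List; []; _∷_; length; concatMap; filter; allFin; _++_; lookup)
open import Data.List.Membership.Propositional using (_∈_; _∉_; find)
open import Data.List.Membership.Propositional.Properties
  using (∈-concatMap⁺; ∈-concatMap⁻; ∈-filter⁺; ∈-filter⁻; ∈-allFin)
open import Data.List.Properties using (length-++)
open import Data.List.Relation.Binary.Permutation.Propositional using (_↭_; ↭-refl; ↭-sym; ↭-trans; ↭-prep; ↭-swap)
open import Data.List.Relation.Binary.Permutation.Propositional.Properties
  using (All-resp-↭; ∈-resp-↭; ↭-length)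
open import Data.List.Relation.Unary.All using (All; []; _∷_)
import Data.List.Relation.Unary.All as All
open import Data.List.Relation.Unary.AllPairs using (AllPairs; []; _∷_)
open import Data.List.Relation.Unary.Any using (here; there)
import Data.List.Relation.Unary.Any as Any
import Data.List.Relation.Unary.Any.Properties as Any
import Data.List.Membership.DecPropositional as DecMembership
import Data.List.Relation.Unary.Unique.Propositional.Properties as Unique
open import Data.Nat using (ℕ; zero; suc; _+_; _*_; _∸_; _^_; _⊔_; _≤_; _<_; _≤ᵇ_; _≡ᵇ_; z≤n; s≤s; z<s;
  _≤′_; ≤′-refl; ≤′-step)
import Data.Nat.Properties as ℕ
open import Data.Product using (Σ; ∃; _×_; _,_; proj₁; proj₂; swap)
open import Data.Sum using (_⊎_; inj₁; inj₂; [_,_]′)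
import Data.Sum as Sum
open import Function using (_∘_; id; flip)
open import Relation.Binary.Definitions using (tri<; tri≈; tri>)
open import Relation.Binary.PropositionalEquality
  using (_≡_; _≢_; refl; sym; trans; cong; cong₂; subst)
open import Relation.Nullary using (¬_; Dec; yes; no; does; contradiction)
open import Relation.Nullary.Decidable using (dec-true; dec-false; decidable-stable; _×-dec_; _⊎-dec_; ¬?; map′; ⌊_⌋)
open import Relation.Unary using (Decidable)

-- Finite structures

Embeds-refl : ∀ S → Embeds S S
Embeds-refl S = id , (λ _ _ eq → eq) , (λ _ _ → refl)

Embeds-trans : ∀ S T U → Embeds S T → Embeds T U → Embeds S U
Embeds-trans S T U (f , f-inj , f-rel) (g , g-inj , g-rel) =
  g ∘ f , (λ x y → f-inj x y ∘ g-inj (f x) (f y)) , λ i j → trans (f-rel i j) (g-rel (f i) (f j))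

Embeds-pointwise : ∀ {n} {R R′ : Fin n → Fin n → Bool} →
  (∀ i j → R i j ≡ R′ i j) → Embeds (mkStr n R) (mkStr n R′)
Embeds-pointwise eq = id , (λ _ _ e → e) , eq

-- Exhaustive search over the codes `funToFin f`. Decidability is what lets `minimal⇒below` pass
-- from a refuted non-embedding to an actual embedding.
embeds? : ∀ S T → Dec (Embeds S T)
embeds? S T =
  map′ (λ (k , f-inj , f-rel) → finToFun k , f-inj , f-rel) encode
    (Fin.any? λ k → isEmbedding? (finToFun k))
  where
  IsEmbedding : (Fin (size S) → Fin (size T)) → Set
  IsEmbedding f = Injective f × (∀ i j → rel S i j ≡ rel T (f i) (f j))

  isEmbedding? : ∀ f → Dec (IsEmbedding f)
  isEmbedding? f =
    Fin.all? (λ x → Fin.all? λ y → implies? (f x ≟ f y) (x ≟ y))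
      ×-dec Fin.all? (λ i → Fin.all? λ j → rel S i j Bool.≟ rel T (f i) (f j))
    where
    implies? : ∀ {A B : Set} → Dec A → Dec B → Dec (A → B)
    implies? _ (yes b) = yes λ _ → b
    implies? (yes a) (no ¬b) = no λ g → ¬b (g a)
    implies? (no ¬a) (no _) = yes λ a → ⊥-elim (¬a a)

  encode : Embeds S T → ∃ λ k → IsEmbedding (finToFun k)
  encode (f , f-inj , f-rel) = funToFin f ,
    (λ x y eq → f-inj x y (trans (sym (eq-f x)) (trans eq (eq-f y)))) ,
    (λ i j → trans (f-rel i j) (sym (cong₂ (rel T) (eq-f i) (eq-f j))))
    where
    eq-f : ∀ i → finToFun (funToFin f) i ≡ f i
    eq-f = Fin.finToFun-funToFin f

covering⇒size≤ : ∀ {n} (xs : List (Fin n)) → (∀ v → v ∈ xs) → n ≤ length xs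
covering⇒size≤ xs all = Fin.injective⇒≤ {f = Any.index ∘ all} λ {u} {v} eq →
  trans (Any.lookup-index (all u)) (trans (cong (lookup xs) eq) (sym (Any.lookup-index (all v))))

-- Lets modules be presented as decidable predicates, with the module law read off from `X` instead
-- of from Boolean equations.
prime-dec : ∀ {S} → Prime S → {X : Fin (size S) → Set} → Decidable X →
  (∀ {v a a′} → ¬ X v → X a → X a′ → (rel S v a ≡ rel S v a′) × (rel S a v ≡ rel S a′ v)) →
  (∀ {x y} → X x → X y → x ≡ y) ⊎ (∀ x → X x)
prime-dec prime {X} X? module-X =
  Sum.map (λ sub {x} {y} Xx Xy → sub x y (dec-true (X? x) Xx) (dec-true (X? y) Xy))
          (λ all x → does-true (X? x) (all x))
          (prime (does ∘ X?) λ v a a′ ¬v ∈a ∈a′ →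
             module-X (does-false (X? v) ¬v) (does-true (X? a) ∈a) (does-true (X? a′) ∈a′))
  where
  does-true : ∀ {P : Set} (p? : Dec P) → does p? ≡ true → P
  does-true (yes p) _ = p

  does-false : ∀ {P : Set} (p? : Dec P) → does p? ≡ false → ¬ P
  does-false (no ¬p) _ = ¬p

-- The formula is the one in `IsIncompGraphW2`, so a graph of that kind agrees pointwise with `inc`
-- of its witnessing poset.
inc : FinStr → FinStr
inc P = mkStr (size P) λ i j → not ⌊ i ≟ j ⌋ ∧ not (rel P i j ∨ rel P j i)

inc-mono : ∀ {P Q} → Embeds P Q → Embeds (inc P) (inc Q)
inc-mono {P} {Q} (f , f-inj , f-rel) = f , f-inj , λ i j →
  cong₂ _∧_ (cong not (does-≟ i j)) (cong not (cong₂ _∨_ (f-rel i j) (f-rel j i)))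
  where
  does-≟ : ∀ i j → ⌊ i ≟ j ⌋ ≡ ⌊ f i ≟ f j ⌋
  does-≟ i j with i ≟ j | f i ≟ f j
  ... | yes _  | yes _  = refl
  ... | no _   | no _   = refl
  ... | yes eq | no ¬eq = contradiction (cong f eq) ¬eq
  ... | no ¬eq | yes eq = contradiction (f-inj i j eq) ¬eq

-- Every module of `P` is a module of `inc P`, because adjacency of distinct vertices is computed
-- from the two entries of `rel P`.
inc-prime⇒prime : ∀ {P} → Prime (inc P) → Prime P
inc-prime⇒prime {P} prime A module-A = prime A λ v a a′ ∉v ∈a ∈a′ →
  let eq , eq′ = module-A v a a′ ∉v ∈a ∈a′ in
  cong₂ _∧_ (trans (≢-false (sep ∉v ∈a)) (sym (≢-false (sep ∉v ∈a′)))) (cong not (cong₂ _∨_ eq eq′)) ,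
  cong₂ _∧_ (trans (≢-false (sep ∉v ∈a ∘ sym)) (sym (≢-false (sep ∉v ∈a′ ∘ sym)))) (cong not (cong₂ _∨_ eq′ eq))
  where
  sep : ∀ {v a} → A v ≡ false → A a ≡ true → v ≢ a
  sep ∉v ∈a refl = contradiction (trans (sym ∉v) ∈a) λ ()

  ≢-false : ∀ {v a} → v ≢ a → not ⌊ v ≟ a ⌋ ≡ true
  ≢-false {v} {a} v≢a with v ≟ a
  ... | yes v≡a = contradiction v≡a v≢a
  ... | no _    = refl

prime-resp : ∀ {n} {R R′ : Fin n → Fin n → Bool} → (∀ i j → R i j ≡ R′ i j) →
  Prime (mkStr n R) → Prime (mkStr n R′)
prime-resp eq prime A module-A = prime A λ v a a′ ∉v ∈a ∈a′ →
  let e , e′ = module-A v a a′ ∉v ∈a ∈a′ in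
  trans (eq v a) (trans e (sym (eq v a′))) , trans (eq a v) (trans e′ (sym (eq a′ v)))

-- Two competing families of primes

Below : (ℕ → FinStr) → Class
Below A S = ∃ λ n → Embeds S (A n)

record PrimeFamily (A : ℕ → FinStr) : Set where
  field
    mono  : ∀ {m n} → m ≤ n → Embeds (A m) (A n)
    prime : ∀ n → Prime (A n)
    large : ∀ n → n ≤ size (A n)

Unavoidable : Class → (A B : ℕ → FinStr) → Set
Unavoidable K A B = ∀ N → ∃ λ M → ∀ P → K P → Prime P → M ≤ size P → Embeds (A N) P ⊎ Embeds (B N) P

Escapes : (A B : ℕ → FinStr) → Set
Escapes A B = ∃ λ k → ∀ n → ¬ Embeds (A k) (B n)

≐-trans : ∀ {C D E} → C ≐ D → D ≐ E → C ≐ E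
≐-trans (cd , dc) (de , ed) = (λ P → de P ∘ cd P) , (λ P → dc P ∘ ed P)

≐-sym : ∀ {C D} → C ≐ D → D ≐ C
≐-sym = swap

module _ {K : Class} {A B : ℕ → FinStr} (famA : PrimeFamily A) (famB : PrimeFamily B)
         (unavoidable : Unavoidable K A B) {C : Class} (her : Hereditary C) (C⊆K : C ⊆C K) where
  private
    module A = PrimeFamily famA
    module B = PrimeFamily famB

  -- A proper hereditary subclass `D` misses some `P` below `A n`. A large prime in `D` would
  -- contain either a member of `A` above `P`, or a member of `B` that cannot lie below `A`.
  below⇒minimal : Escapes B A → C ≐ Below A → MinimalPrime C
  below⇒minimal (k , B⊀A) (C⊆A , A⊆C) = her , infinite , minimal
    where
    infinite : InfManyPrimes C
    infinite m = A m , A⊆C (A m) (m , Embeds-refl (A m)) , A.prime m , A.large m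

    minimal : ∀ D → Hereditary D → D ⊆C C → (Σ FinStr λ P → C P × ¬ D P) → FinManyPrimes D
    minimal D herD D⊆C (P , C∋P , D∌P) with C⊆A P C∋P
    -- The index serves both outcomes: `n` to catch `P`, `k` to catch the escaping `B k`.
    ... | n , P≤An with unavoidable (k ⊔ n)
    ... | M , forced = M , λ Q D∋Q primeQ → ℕ.≰⇒> λ M≤Q →
      [ (λ A≤Q → D∌P (herD Q P D∋Q (Embeds-trans P (A n) Q P≤An
          (Embeds-trans (A n) (A (k ⊔ n)) Q (A.mono (ℕ.m≤n⊔m k n)) A≤Q))))
      , (λ B≤Q → let m , Q≤Am = C⊆A Q (D⊆C Q D∋Q) in
          B⊀A m (Embeds-trans (B k) (B (k ⊔ n)) (A m) (B.mono (ℕ.m≤m⊔n k n)) (Embeds-trans (B (k ⊔ n)) Q (A m) B≤Q Q≤Am)))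
      ]′ (forced Q (C⊆K Q (D⊆C Q D∋Q)) primeQ M≤Q)

  minimal⇒below : (e : Escapes A B) → C (A (proj₁ e)) → MinimalPrime C → C ≐ Below A
  minimal⇒below (k , A⊀B) C∋Ak (_ , infinite , minimal) = C⊆A , λ P (n , P≤An) → her (A n) P (C∋A n) P≤An
    where
    Avoiding : FinStr → Class
    Avoiding S P = C P × ¬ Embeds S P

    bounded : ∀ S → C S → FinManyPrimes (Avoiding S)
    bounded S C∋S = minimal (Avoiding S)
      (λ P Q (C∋P , S≰P) Q≤P → her P Q C∋P Q≤P , λ S≤Q → S≰P (Embeds-trans S Q P S≤Q Q≤P))
      (λ _ → proj₁) (S , C∋S , λ (_ , S≰S) → S≰S (Embeds-refl S))

    C∋A : ∀ n → C (A n)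
    C∋A n with bounded (A k) C∋Ak
    -- The index `n` yields `A n` in the first outcome; `m` makes `B (n ⊔ m)` too large for a prime
    -- of `C` that avoids `A k`, which rules out the second.
    ... | m , small with unavoidable (n ⊔ m)
    ... | M , forced with infinite M
    ... | P , C∋P , primeP , M≤P =
      [ (λ A≤P → her P (A n) C∋P (Embeds-trans (A n) (A (n ⊔ m)) P (A.mono (ℕ.m≤m⊔n n m)) A≤P))
      , (λ B≤P → contradiction
          (ℕ.≤-trans (ℕ.m≤n⊔m n m) (B.large (n ⊔ m)))
          (ℕ.<⇒≱ (small (B (n ⊔ m)) (her P (B (n ⊔ m)) C∋P B≤P , A⊀B (n ⊔ m)) (B.prime (n ⊔ m)))))
      ]′ (forced P (C⊆K P C∋P) primeP M≤P)

    C⊆A : C ⊆C Below A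
    C⊆A P C∋P with bounded P C∋P
    -- If `P` did not embed in `A m`, then `A m` would be a prime of `C` avoiding `P`, hence of size
    -- below `m`.
    ... | m , small = m , decidable-stable (embeds? P (A m)) λ P≰Am →
      contradiction (A.large m) (ℕ.<⇒≱ (small (A m) (C∋A m , P≰Am) (A.prime m)))

dichotomy : ∀ {K : Class} {A B : ℕ → FinStr} → PrimeFamily A → PrimeFamily B →
  Unavoidable K A B → Escapes A B → Escapes B A →
  ∀ (C : Class) → Hereditary C → C ⊆C K → MinimalPrime C ⇔₁ ((C ≐ Below A) ⊎ (C ≐ Below B))
dichotomy {K} {A} {B} famA famB unavoidable A⊀B B⊀A C her C⊆K = forth , back
  where
  unavoidable′ : Unavoidable K B A
  unavoidable′ N = let M , forced = unavoidable N in
    M , λ P K∋P primeP M≤P → Sum.swap (forced P K∋P primeP M≤P)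

  a = proj₁ A⊀B
  b = proj₁ B⊀A

  forth : MinimalPrime C → (C ≐ Below A) ⊎ (C ≐ Below B)
  -- Large enough that either outcome puts an escaping member, `A a` or `B b`, into `C`.
  forth min@(_ , infinite , _) with unavoidable (a ⊔ b)
  ... | M , forced with infinite M
  ... | P , C∋P , primeP , M≤P with forced P (C⊆K P C∋P) primeP M≤P
  ... | inj₁ A≤P = inj₁ (minimal⇒below famA famB unavoidable her C⊆K A⊀B
        (her P (A a) C∋P (Embeds-trans (A a) (A (a ⊔ b)) P (PrimeFamily.mono famA (ℕ.m≤m⊔n a b)) A≤P)) min)
  ... | inj₂ B≤P = inj₂ (minimal⇒below famB famA unavoidable′ her C⊆K B⊀A
        (her P (B b) C∋P (Embeds-trans (B b) (B (a ⊔ b)) P (PrimeFamily.mono famB (ℕ.m≤n⊔m a b)) B≤P)) min)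

  back : (C ≐ Below A) ⊎ (C ≐ Below B) → MinimalPrime C
  back (inj₁ C≐A) = below⇒minimal famA famB unavoidable her C⊆K B⊀A C≐A
  back (inj₂ C≐B) = below⇒minimal famB famA unavoidable′ her C⊆K A⊀B C≐B

-- Relations on ℕ and their initial segments

restrict : (ℕ → ℕ → Bool) → ℕ → FinStr
restrict R n = mkStr n λ i j → R (toℕ i) (toℕ j)

restrict-mono : ∀ R {m n} → m ≤ n → Embeds (restrict R m) (restrict R n)
restrict-mono R m≤n = (λ i → inject≤ i m≤n) , (λ _ _ → Fin.inject≤-injective m≤n m≤n _ _) , λ i j →
  sym (cong₂ R (Fin.toℕ-inject≤ i m≤n) (Fin.toℕ-inject≤ j m≤n))

≤ᵇ-true : ∀ {i j} → i ≤ j → (i ≤ᵇ j) ≡ true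
≤ᵇ-true {i} {j} = dec-true (i ℕ.≤? j)

≤ᵇ-false : ∀ {i j} → j < i → (i ≤ᵇ j) ≡ false
≤ᵇ-false {i} {j} = dec-false (i ℕ.≤? j) ∘ ℕ.<⇒≱

≡ᵇ-true : ∀ {i j} → i ≡ j → (i ≡ᵇ j) ≡ true
≡ᵇ-true {i} {j} = dec-true (i ℕ.≟ j)

≡ᵇ-false : ∀ {i j} → i ≢ j → (i ≡ᵇ j) ≡ false
≡ᵇ-false {i} {j} = dec-false (i ℕ.≟ j)

-- Used to reverse the numbering of a path: gaps of at least two survive.
∸-gap : ∀ {i j K} → suc i < j → j ≤ K → suc (K ∸ j) < K ∸ i
∸-gap {i} {j} {K} i+1<j j≤K =
  ℕ.≤-trans (ℕ.≤-reflexive (sym (ℕ.+-∸-assoc 2 j≤K))) (ℕ.∸-monoʳ-≤ (2 + K) i+1<j)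

age-reindex : ∀ {V W : Set} (R : V → V → Bool) (R′ : W → W → Bool) (e : V → W) → Injective e →
  (∀ u v → R u v ≡ R′ (e u) (e v)) → Age R ⊆C Age R′
age-reindex R R′ e e-inj e-rel S (f , f-inj , f-rel) =
  e ∘ f , (λ x y → f-inj x y ∘ e-inj (f x) (f y)) , λ i j → trans (f-rel i j) (e-rel (f i) (f j))

upperBound : ∀ {n} (f : Fin n → ℕ) → ∃ λ b → ∀ i → f i < b
upperBound {zero} f = 0 , λ ()
upperBound {suc n} f with upperBound (f ∘ suc)
... | b , f<b = suc (f zero) ⊔ b , λ
  { zero → ℕ.m≤m⊔n (suc (f zero)) b
  ; (suc i) → ℕ.≤-trans (f<b i) (ℕ.m≤n⊔m (suc (f zero)) b) }

-- A finite set of naturals has a bound `b`, and `b ≤ s b`; so initial segments of the lengths `s n`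
-- exhaust the age even when `s` skips lengths.
age≐below : ∀ R (s : ℕ → ℕ) → (∀ n → n ≤ s n) → Age R ≐ Below (restrict R ∘ s)
age≐below R s large = into , onto
  where
  into : Age R ⊆C Below (restrict R ∘ s)
  into S (f , f-inj , f-rel) with upperBound f
  ... | b , f<b = b , (λ i → fromℕ< (f<s i)) ,
      (λ x y eq → f-inj x y (trans (sym (Fin.toℕ-fromℕ< (f<s x))) (trans (cong toℕ eq) (Fin.toℕ-fromℕ< (f<s y))))) ,
      λ i j → trans (f-rel i j) (sym (cong₂ R (Fin.toℕ-fromℕ< (f<s i)) (Fin.toℕ-fromℕ< (f<s j))))
    where
    f<s : ∀ i → f i < s b
    f<s i = ℕ.≤-trans (f<b i) (large b)

  onto : Below (restrict R ∘ s) ⊆C Age R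
  onto S (n , f , f-inj , f-rel) = toℕ ∘ f , (λ x y → f-inj x y ∘ Fin.toℕ-injective) , f-rel

-- A module absorbs every vertex that distinguishes two of its members. It therefore suffices that
-- this closure, started from any two points, fills the segment. Subsets of `ℕ` replace subsets of
-- `Fin n` so that the applications are plain arithmetic.
restrict-prime : ∀ {R n} →
  (∀ {X : ℕ → Set} → (∀ {x} → X x → x < n) →
    (∀ {v x y} → v < n → X x → X y → R v x ≢ R v y → X v) →
    ∀ {x y} → X x → X y → x < y → ∀ {v} → v < n → X v) →
  Prime (restrict R n)
restrict-prime {R} {n} spread A module-A =
  trivial (Fin.any? λ x → Fin.any? λ y → (A x Bool.≟ true) ×-dec (A y Bool.≟ true) ×-dec ¬? (x ≟ y))
  where
  X : ℕ → Set
  X k = Σ (Fin n) λ i → (toℕ i ≡ k) × (A i ≡ true)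

  X-bound : ∀ {x} → X x → x < n
  X-bound (i , refl , _) = Fin.toℕ<n i

  X-step : ∀ {v x y} → v < n → X x → X y → R v x ≢ R v y → X v
  X-step {v} v<n (i , refl , ∈i) (j , refl , ∈j) split with A (fromℕ< v<n) in eq
  ... | true  = fromℕ< v<n , Fin.toℕ-fromℕ< v<n , eq
  ... | false = contradiction
    (subst (λ w → R w (toℕ i) ≡ R w (toℕ j)) (Fin.toℕ-fromℕ< v<n) (proj₁ (module-A (fromℕ< v<n) i j eq ∈i ∈j)))
    split

  total : ∀ {x y} → X x → X y → x < y → ∀ i → A i ≡ true
  total Xx Xy x<y i with spread X-bound X-step Xx Xy x<y (Fin.toℕ<n i)
  ... | j , eq , ∈j = subst (λ k → A k ≡ true) (Fin.toℕ-injective eq) ∈j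

  trivial : Dec (∃ λ x → ∃ λ y → (A x ≡ true) × (A y ≡ true) × x ≢ y) → Trivial (restrict R n) A
  trivial (no none) = inj₁ λ x y ∈x ∈y → decidable-stable (x ≟ y) λ x≢y → none (x , y , ∈x , ∈y , x≢y)
  trivial (yes (x , y , ∈x , ∈y , x≢y)) with ℕ.<-cmp (toℕ x) (toℕ y)
  ... | tri< x<y _ _ = inj₂ (total (x , refl , ∈x) (y , refl , ∈y) x<y)
  ... | tri≈ _ eq _  = contradiction (Fin.toℕ-injective eq) x≢y
  ... | tri> _ _ y<x = inj₂ (total (y , refl , ∈y) (x , refl , ∈x) y<x)

incℕ : (ℕ → ℕ → Bool) → ℕ → ℕ → Bool
incℕ R i j = not (i ≡ᵇ j) ∧ not (R i j ∨ R j i)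

inc-restrict : ∀ R n i j → rel (inc (restrict R n)) i j ≡ rel (restrict (incℕ R) n) i j
inc-restrict R n i j = cong (λ b → not b ∧ not (R (toℕ i) (toℕ j) ∨ R (toℕ j) (toℕ i))) does-≟
  where
  does-≟ : ⌊ i ≟ j ⌋ ≡ (toℕ i ≡ᵇ toℕ j)
  does-≟ with i ≟ j
  ... | yes refl = sym (≡ᵇ-true {toℕ i} refl)
  ... | no i≢j   = sym (≡ᵇ-false (i≢j ∘ Fin.toℕ-injective))

-- Such an `R` is contained in the natural order, so it and its incomparability graph are determined
-- by the values at `i < j`.
record Natural (R : ℕ → ℕ → Bool) : Set where
  field
    reflexive : ∀ i → R i i ≡ true
    upward    : ∀ {i j} → i < j → R j i ≡ false

  inc-irrefl : ∀ i → incℕ R i i ≡ false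
  inc-irrefl i = cong (λ b → not b ∧ not (R i i ∨ R i i)) (≡ᵇ-true {i} refl)

  inc-< : ∀ {i j} → i < j → incℕ R i j ≡ not (R i j)
  inc-< {i} {j} i<j =
    cong₂ (λ b c → not b ∧ not c) (≡ᵇ-false (ℕ.<⇒≢ i<j)) (trans (cong (R i j ∨_) (upward i<j)) (Bool.∨-identityʳ _))

  inc-> : ∀ {i j} → i < j → incℕ R j i ≡ not (R i j)
  inc-> {i} {j} i<j =
    cong₂ (λ b c → not b ∧ not c) (≡ᵇ-false (ℕ.>⇒≢ i<j)) (cong (_∨ R i j) (upward i<j))

-- The poset P₁ and the half graph

double : ℕ → ℕ
double zero    = zero
double (suc n) = suc (suc (double n))

n≤double : ∀ n → n ≤ double n
n≤double zero    = z≤n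
n≤double (suc n) = s≤s (ℕ.m≤n⇒m≤1+n (n≤double n))

double-mono : ∀ {m n} → m ≤ n → double m ≤ double n
double-mono z≤n       = z≤n
double-mono (s≤s m≤n) = s≤s (s≤s (double-mono m≤n))

isEven-double : ∀ n → isEven (double n) ≡ true
isEven-double zero    = refl
isEven-double (suc n) = trans (Bool.not-involutive _) (isEven-double n)

le-ωω-≤ : ∀ {i j} → i ≤ j → le-ωω i j ≡ not (isEven i ∧ not (isEven j))
le-ωω-≤ {i} {j} i≤j with isEven i | isEven j
... | false | true  = refl
... | true  | false = refl
... | true  | true  = ≤ᵇ-true i≤j
... | false | false = ≤ᵇ-true i≤j

-- The order `le-ωω` puts odd numbers first, so it reverses a naturally ordered pair exactly when an
-- even number precedes an odd one.
P₁-≤ : ∀ {i j} → i ≤ j → P₁ i j ≡ not (isEven i ∧ not (isEven j))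
P₁-≤ i≤j = cong₂ _∧_ (≤ᵇ-true i≤j) (le-ωω-≤ i≤j)

P₁-natural : Natural P₁
P₁-natural = record
  { reflexive = λ i → trans (P₁-≤ {i} ℕ.≤-refl) (cong not (Bool.∧-inverseʳ (isEven i)))
  ; upward = λ {i} {j} i<j → cong (_∧ le-ωω j i) (≤ᵇ-false i<j) }

-- This is `H` with `a_i` placed at `2i` and `b_j` at `2j + 1`, since `i ≤ j` amounts to
-- `2i < 2j + 1`.
half : ℕ → ℕ → Bool
half = incℕ P₁

half-< : ∀ {i j} → i < j → half i j ≡ isEven i ∧ not (isEven j)
half-< i<j = trans (Natural.inc-< P₁-natural i<j)
  (trans (cong not (P₁-≤ (ℕ.<⇒≤ i<j))) (Bool.not-involutive _))

half-> : ∀ {i j} → i < j → half j i ≡ isEven i ∧ not (isEven j)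
half-> i<j = trans (Natural.inc-> P₁-natural i<j)
  (trans (cong not (P₁-≤ (ℕ.<⇒≤ i<j))) (Bool.not-involutive _))

half-sameParity : ∀ i j → isEven i ≡ isEven j → half i j ≡ false
half-sameParity i j eq with ℕ.<-cmp i j
... | tri< i<j _ _  = trans (half-< i<j) (trans (cong (λ b → b ∧ not (isEven j)) eq) (Bool.∧-inverseʳ (isEven j)))
... | tri≈ _ refl _ = Natural.inc-irrefl P₁-natural i
... | tri> _ _ j<i  = trans (half-> j<i) (trans (cong (λ b → b ∧ not (isEven i)) (sym eq)) (Bool.∧-inverseʳ (isEven i)))

half-edge : ∀ {e o} → isEven e ≡ true → isEven o ≡ false → e < o → half e o ≡ true
half-edge ev od e<o = trans (half-< e<o) (cong₂ (λ b c → b ∧ not c) ev od)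

half-edge′ : ∀ {e o} → isEven e ≡ true → isEven o ≡ false → e < o → half o e ≡ true
half-edge′ ev od e<o = trans (half-> e<o) (cong₂ (λ b c → b ∧ not c) ev od)

half-nonedge : ∀ {e o} → isEven e ≡ true → isEven o ≡ false → o < e → half e o ≡ false
half-nonedge ev od o<e = trans (half-> o<e) (cong₂ (λ b c → b ∧ not c) od ev)

half-nonedge′ : ∀ {e o} → isEven e ≡ true → isEven o ≡ false → o < e → half o e ≡ false
half-nonedge′ ev od o<e = trans (half-< o<e) (cong₂ (λ b c → b ∧ not c) od ev)

true-false⇒≢ : ∀ {a b : Bool} → a ≡ true → b ≡ false → a ≢ b
true-false⇒≢ refl refl ()

-- The vertex `0` sees all odd vertices and the last vertex sees all even ones, so a module
-- containing both is everything; the cases of `spread` bring both in. Lengths are even because a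
-- segment of odd length at least three ends in an isolated vertex, whose complement is a nontrivial
-- module.
half-prime : ∀ n → Prime (restrict half (double n))
half-prime zero = λ _ _ → inj₁ λ ()
half-prime (suc m) = restrict-prime spread
  where
  last : ℕ
  last = suc (double m)

  last-odd : isEven last ≡ false
  last-odd = cong not (isEven-double m)

  module _ {X : ℕ → Set} (bound : ∀ {x} → X x → x < suc last)
           (step : ∀ {v x y} → v < suc last → X x → X y → half v x ≢ half v y → X v) where

    parity : ∀ {x y} → isEven x ≡ true → isEven y ≡ false → x ≢ y
    parity ev od refl = contradiction (trans (sym ev) od) λ ()

    -- From an even x < odd y in the module, every odd v > x and every even v < y join.
    odd-joins : ∀ {x y v} → X x → X y → isEven x ≡ true → isEven y ≡ false → x < v → isEven v ≡ false →
      v < suc last → X v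
    odd-joins {x} {y} {v} Xx Xy ev od x<v odv v< =
      step v< Xx Xy (true-false⇒≢ (half-edge′ ev odv x<v) (half-sameParity v y (trans odv (sym od))))

    even-joins : ∀ {x y v} → X x → X y → isEven x ≡ true → isEven y ≡ false → v < y → isEven v ≡ true →
      v < suc last → X v
    even-joins {x} {y} {v} Xx Xy ev od v<y evv v< =
      step v< Xy Xx (true-false⇒≢ (half-edge evv od v<y) (half-sameParity v x (trans evv (sym ev))))

    from-extremes : X 0 → X last → ∀ {v} → v < suc last → X v
    from-extremes X0 Xl {zero} v< = X0
    from-extremes X0 Xl {suc v} v< with isEven (suc v) in eq
    ... | false = odd-joins X0 Xl refl last-odd z<s eq v<
    ... | true  = even-joins X0 Xl refl last-odd
                    (ℕ.≤∧≢⇒< (ℕ.≤-pred v<) (parity eq last-odd)) eq v<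

    spread-even-odd : ∀ {x y} → X x → X y → isEven x ≡ true → isEven y ≡ false → x < y →
      ∀ {v} → v < suc last → X v
    spread-even-odd {x} {y} Xx Xy ev od x<y = from-extremes
      (even-joins Xx Xy ev od (ℕ.≤-<-trans z≤n x<y) refl z<s)
      (odd-joins Xx Xy ev od (ℕ.<-≤-trans x<y (ℕ.≤-pred (bound Xy))) last-odd ℕ.≤-refl)

    spread : ∀ {x y} → X x → X y → x < y → ∀ {v} → v < suc last → X v
    spread {x} {suc y} Xx Xy x<y with isEven x in ex | isEven (suc y) in ey
    ... | true  | false = spread-even-odd Xx Xy ex ey x<y
    -- Two even vertices are distinguished by the odd successor of the smaller; in the next case,
    -- two odd ones by the even predecessor of the larger. This reduces both to an even vertex below
    -- an odd one.
    ... | true  | true  = spread-even-odd Xx Xv ex od (ℕ.n<1+n x)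
      where
      od : isEven (suc x) ≡ false
      od = cong not ex
      x+1≢ : suc x ≢ suc y
      x+1≢ eq = contradiction (trans (sym ey) (trans (cong isEven (sym eq)) od)) λ ()
      Xv : X (suc x)
      Xv = step (ℕ.<-trans (ℕ.≤∧≢⇒< x<y x+1≢) (bound Xy)) Xx Xy
        (true-false⇒≢ (half-edge′ ex od (ℕ.n<1+n x)) (half-nonedge′ ey od (ℕ.≤∧≢⇒< x<y x+1≢)))
    ... | false | false = spread-even-odd Xv Xy ev ey (ℕ.n<1+n y)
      where
      ev : isEven y ≡ true
      ev = trans (sym (Bool.not-involutive _)) (cong not ey)
      Xv : X y
      Xv = step (ℕ.<-trans (ℕ.n<1+n y) (bound Xy)) Xy Xx
        (true-false⇒≢ (half-edge ev ey (ℕ.n<1+n y)) (half-nonedge ev ex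
          (ℕ.≤∧≢⇒< (ℕ.≤-pred x<y) (parity ev ex ∘ sym))))
    -- The odd `x` is adjacent to `0` and the even `suc y` to `last`, while neither end is adjacent
    -- to a vertex of its own parity.
    ... | false | true  = from-extremes
      (step z<s Xx Xy (true-false⇒≢ (half-edge {0} {x} refl ex (odd-positive ex)) (half-sameParity 0 (suc y) (sym ey))))
      (step ℕ.≤-refl Xy Xx (true-false⇒≢ (half-edge′ ey last-odd y<last) (half-sameParity last x (trans last-odd (sym ex)))))
      where
      odd-positive : ∀ {k} → isEven k ≡ false → 0 < k
      odd-positive {suc k} _ = z<s
      y<last : suc y < last
      y<last = ℕ.≤∧≢⇒< (ℕ.≤-pred (bound Xy)) (parity ey last-odd)

interleave : ℕ ⊎ ℕ → ℕ
interleave (inj₁ i) = double i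
interleave (inj₂ j) = suc (double j)

side : ℕ → ℕ ⊎ ℕ
side zero          = inj₁ zero
side (suc zero)    = inj₂ zero
side (suc (suc n)) = Sum.map suc suc (side n)

interleave-side : ∀ n → interleave (side n) ≡ n
interleave-side zero          = refl
interleave-side (suc zero)    = refl
interleave-side (suc (suc n)) = trans (shift (side n)) (cong (λ k → suc (suc k)) (interleave-side n))
  where
  shift : ∀ u → interleave (Sum.map suc suc u) ≡ suc (suc (interleave u))
  shift (inj₁ _) = refl
  shift (inj₂ _) = refl

side-interleave : ∀ u → side (interleave u) ≡ u
side-interleave (inj₁ zero)    = refl
side-interleave (inj₁ (suc i)) = cong (Sum.map suc suc) (side-interleave (inj₁ i))
side-interleave (inj₂ zero)    = refl
side-interleave (inj₂ (suc j)) = cong (Sum.map suc suc) (side-interleave (inj₂ j))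

leftInverse⇒injective : ∀ {V W : Set} {f : V → W} (g : W → V) → (∀ v → g (f v) ≡ v) → Injective f
leftInverse⇒injective g inv x y eq = trans (sym (inv x)) (trans (cong g eq) (inv y))

H≡half : ∀ u v → H u v ≡ half (interleave u) (interleave v)
H≡half (inj₁ i) (inj₁ j) = sym (half-sameParity (double i) (double j) (trans (isEven-double i) (sym (isEven-double j))))
H≡half (inj₂ i) (inj₂ j) = sym (half-sameParity (suc (double i)) (suc (double j))
  (cong not (trans (isEven-double i) (sym (isEven-double j)))))
H≡half (inj₁ i) (inj₂ j) with i ℕ.≤? j
... | yes i≤j = trans (≤ᵇ-true i≤j)
        (sym (half-edge (isEven-double i) (cong not (isEven-double j)) (s≤s (double-mono i≤j))))
... | no i≰j  = trans (≤ᵇ-false (ℕ.≰⇒> i≰j))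
        (sym (half-nonedge (isEven-double i) (cong not (isEven-double j)) (double-mono (ℕ.≰⇒> i≰j))))
H≡half (inj₂ j) (inj₁ i) with i ℕ.≤? j
... | yes i≤j = trans (≤ᵇ-true i≤j)
        (sym (half-edge′ (isEven-double i) (cong not (isEven-double j)) (s≤s (double-mono i≤j))))
... | no i≰j  = trans (≤ᵇ-false (ℕ.≰⇒> i≰j))
        (sym (half-nonedge′ (isEven-double i) (cong not (isEven-double j)) (double-mono (ℕ.≰⇒> i≰j))))

ageH≐age-half : Age H ≐ Age half
ageH≐age-half =
  age-reindex H half interleave (leftInverse⇒injective side side-interleave) H≡half ,
  age-reindex half H side (leftInverse⇒injective interleave interleave-side) λ i j →
    sym (trans (H≡half (side i) (side j)) (cong₂ half (interleave-side i) (interleave-side j)))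

-- The poset P₂ and the path

P∞-near : ∀ i → P∞ i (suc i) ≡ true
P∞-near i = cong (_∨ (suc (suc i) ≡ᵇ i)) (≡ᵇ-true {i} refl)

P∞-sym : ∀ i j → P∞ i j ≡ P∞ j i
P∞-sym i j = Bool.∨-comm (suc i ≡ᵇ j) (suc j ≡ᵇ i)

P∞-near′ : ∀ i → P∞ (suc i) i ≡ true
P∞-near′ i = trans (P∞-sym (suc i) i) (P∞-near i)

P∞-far : ∀ {i j} → suc i < j → P∞ i j ≡ false
P∞-far i+1<j = cong₂ _∨_ (≡ᵇ-false (ℕ.<⇒≢ i+1<j))
  (≡ᵇ-false (ℕ.>⇒≢ (ℕ.<-trans (ℕ.n<1+n _) (ℕ.m<n⇒m<1+n i+1<j))))

P∞-far′ : ∀ {i j} → suc i < j → P∞ j i ≡ false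
P∞-far′ {i} {j} i+1<j = trans (P∞-sym j i) (P∞-far i+1<j)

P∞-irrefl : ∀ i → P∞ i i ≡ false
P∞-irrefl i = cong₂ _∨_ (≡ᵇ-false (ℕ.1+n≢n {i})) (≡ᵇ-false (ℕ.1+n≢n {i}))

-- A module with two consecutive vertices absorbs the path in both directions. The offset `4` skips
-- the path on three vertices, whose two ends form a module.
path-prime : ∀ n → Prime (restrict P∞ (4 + n))
path-prime n = restrict-prime spread
  where
  module _ {X : ℕ → Set} (bound : ∀ {x} → X x → x < 4 + n)
           (step : ∀ {v x y} → v < 4 + n → X x → X y → P∞ v x ≢ P∞ v y → X v) where

    up : ∀ {i} → X i → X (suc i) → suc (suc i) < 4 + n → X (suc (suc i))
    up {i} Xi Xi+1 v< = step v< Xi+1 Xi (true-false⇒≢ (P∞-near′ (suc i)) (P∞-far′ {i} ℕ.≤-refl))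

    down : ∀ {i} → X (suc i) → X (suc (suc i)) → X i
    down {i} Xi+1 Xi+2 = step (ℕ.<-trans (ℕ.n<1+n i) (bound Xi+1)) Xi+1 Xi+2
      (true-false⇒≢ (P∞-near i) (P∞-far {i} ℕ.≤-refl))

    from-start : X 0 → X 1 → ∀ v → suc v < 4 + n → X v × X (suc v)
    from-start X0 X1 zero v< = X0 , X1
    from-start X0 X1 (suc v) v< with from-start X0 X1 v (ℕ.<-trans (ℕ.n<1+n _) v<)
    ... | Xv , Xv+1 = Xv+1 , up Xv Xv+1 v<

    from-adjacent : ∀ i → X i → X (suc i) → ∀ {v} → v < 4 + n → X v
    from-adjacent zero X0 X1 {zero} v< = X0
    from-adjacent zero X0 X1 {suc v} v< = proj₂ (from-start X0 X1 v v<)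
    from-adjacent (suc i) Xi Xi+1 = from-adjacent i (down Xi Xi+1) Xi

    spread : ∀ {x y} → X x → X y → x < y → ∀ {v} → v < 4 + n → X v
    spread {x} {y} Xx Xy x<y with ℕ.m≤n⇒m<n∨m≡n x<y
    ... | inj₂ refl = from-adjacent x Xx Xy
    ... | inj₁ x+1<y with ℕ.m≤n⇒m<n∨m≡n x+1<y
    ... | inj₁ x+2<y = from-adjacent x Xx
          (step (ℕ.<-trans x+1<y (bound Xy)) Xx Xy (true-false⇒≢ (P∞-near′ x) (P∞-far x+2<y)))
    -- At distance two the middle vertex sees both ends, so an outer neighbour must separate them:
    -- the successor of `y`, or, if `y` is last, the predecessor `n` of `x`, which exists because
    -- there are at least four vertices.
    ... | inj₂ refl with ℕ.m≤n⇒m<n∨m≡n (bound Xy)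
    ... | inj₁ x+3< = from-adjacent y Xy
          (step x+3< Xy Xx (true-false⇒≢ (P∞-near′ y) (P∞-far′ {x} (ℕ.<-trans (ℕ.n<1+n _) (ℕ.n<1+n _)))))
    ... | inj₂ refl = from-adjacent n
          (step (ℕ.<-trans (ℕ.n<1+n n) (bound Xx)) Xx Xy
            (true-false⇒≢ (P∞-near n) (P∞-far {n} (ℕ.<-trans (ℕ.n<1+n _) (ℕ.n<1+n _)))))
          Xx

pathOrder : ℕ → ℕ → Bool
pathOrder i j = (i ≡ᵇ j) ∨ (suc (suc i) ≤ᵇ j)

pathOrder-near : ∀ i → pathOrder i (suc i) ≡ false
pathOrder-near i = cong₂ _∨_ (≡ᵇ-false (ℕ.<⇒≢ (ℕ.n<1+n i))) (≤ᵇ-false (ℕ.n<1+n (suc i)))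

pathOrder-far : ∀ {i j} → suc i < j → pathOrder i j ≡ true
pathOrder-far {i} {j} i+1<j = trans (cong ((i ≡ᵇ j) ∨_) (≤ᵇ-true i+1<j)) (Bool.∨-zeroʳ _)

pathOrder-natural : Natural pathOrder
pathOrder-natural = record
  { reflexive = λ i → cong (_∨ (suc (suc i) ≤ᵇ i)) (≡ᵇ-true {i} refl)
  ; upward = λ i<j → cong₂ _∨_ (≡ᵇ-false (ℕ.>⇒≢ i<j)) (≤ᵇ-false (ℕ.m<n⇒m<1+n (ℕ.m<n⇒m<1+n i<j))) }

inc-pathOrder : ∀ i j → incℕ pathOrder i j ≡ P∞ i j
inc-pathOrder i j with ℕ.<-cmp i j
... | tri≈ _ refl _ = trans (Natural.inc-irrefl pathOrder-natural i) (sym (P∞-irrefl i))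
... | tri< i<j _ _ with ℕ.m≤n⇒m<n∨m≡n i<j
...   | inj₁ far  = trans (Natural.inc-< pathOrder-natural i<j) (trans (cong not (pathOrder-far far)) (sym (P∞-far far)))
...   | inj₂ refl = trans (Natural.inc-< pathOrder-natural i<j) (trans (cong not (pathOrder-near i)) (sym (P∞-near i)))
inc-pathOrder i j | tri> _ _ j<i with ℕ.m≤n⇒m<n∨m≡n j<i
...   | inj₁ far  = trans (Natural.inc-> pathOrder-natural j<i) (trans (cong not (pathOrder-far far)) (sym (P∞-far′ far)))
...   | inj₂ refl = trans (Natural.inc-> pathOrder-natural j<i) (trans (cong not (pathOrder-near j)) (sym (P∞-near′ j)))

-- The incomparability graph of P₂ is the path 0, 2, 1, 4, 3, 6, 5, …
π : ℕ → ℕ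
π zero    = zero
π (suc m) = if isEven m then suc (suc m) else m

π-even : ∀ i → isEven i ≡ true → π i ≡ i ∸ 1
π-even zero _ = refl
π-even (suc m) ev with isEven m
... | false = refl

π-odd : ∀ i → isEven i ≡ false → π i ≡ suc i
π-odd (suc m) od with isEven m
... | true = refl

-- While `π` swaps `2k - 1` with `2k`, the composite of `σ` with `π` swaps `2k` with `2k + 1`.
σπ-even : ∀ i → isEven i ≡ true → σ (π i) ≡ suc i
σπ-even zero _ = refl
σπ-even (suc zero) ()
σπ-even (suc (suc zero)) _ = refl
σπ-even (suc (suc (suc m))) ev with isEven m in eq
... | false rewrite eq = ℕ.+-comm m 4

σπ-odd : ∀ i → isEven i ≡ false → σ (π i) ≡ i ∸ 1
σπ-odd (suc m) od with isEven m in eq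
... | true rewrite eq = refl

π-involutive : ∀ i → π (π i) ≡ i
π-involutive zero = refl
π-involutive (suc m) with isEven m in eq
... | true rewrite eq = refl
π-involutive (suc (suc m)) | false with isEven m
... | true = refl

±1-bounds : ∀ {f : ℕ → ℕ} → (∀ i → (f i ≡ suc i) ⊎ (f i ≡ i ∸ 1)) → ∀ i → (i ∸ 1 ≤ f i) × (f i ≤ suc i)
±1-bounds f-cases i with f-cases i
... | inj₁ eq = ℕ.≤-trans (ℕ.m∸n≤m i 1) (ℕ.≤-trans (ℕ.n≤1+n i) (ℕ.≤-reflexive (sym eq))) , ℕ.≤-reflexive eq
... | inj₂ eq = ℕ.≤-reflexive (sym eq) , ℕ.≤-trans (ℕ.≤-reflexive eq) (ℕ.≤-trans (ℕ.m∸n≤m i 1) (ℕ.n≤1+n i))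

π-bounds : ∀ i → (i ∸ 1 ≤ π i) × (π i ≤ suc i)
π-bounds = ±1-bounds cases
  where
  cases : ∀ i → (π i ≡ suc i) ⊎ (π i ≡ i ∸ 1)
  cases i with isEven i in eq
  ... | true  = inj₂ (π-even i eq)
  ... | false = inj₁ (π-odd i eq)

σπ-bounds : ∀ i → (i ∸ 1 ≤ σ (π i)) × (σ (π i) ≤ suc i)
σπ-bounds = ±1-bounds cases
  where
  cases : ∀ i → (σ (π i) ≡ suc i) ⊎ (σ (π i) ≡ i ∸ 1)
  cases i with isEven i in eq
  ... | true  = inj₁ (σπ-even i eq)
  ... | false = inj₂ (σπ-odd i eq)

P₂-true : ∀ {i j} → i ≤ j → σ i ≤ σ j → P₂ i j ≡ true
P₂-true i≤j σi≤σj = cong₂ _∧_ (≤ᵇ-true i≤j) (≤ᵇ-true σi≤σj)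

P₂-false : ∀ {i j} → (j < i) ⊎ (σ j < σ i) → P₂ i j ≡ false
P₂-false {i} {j} (inj₁ j<i) = cong (_∧ (σ i ≤ᵇ σ j)) (≤ᵇ-false j<i)
P₂-false {i} {j} (inj₂ σj<σi) = trans (cong ((i ≤ᵇ j) ∧_) (≤ᵇ-false σj<σi)) (Bool.∧-zeroʳ _)

-- Both `π` and `σ ∘ π` move a number by at most one, so they keep the order of numbers at least two
-- apart. Two consecutive numbers are swapped by one of the two permutations, chosen by parity, and
-- so become incomparable.
P₂-π : ∀ i j → P₂ (π i) (π j) ≡ pathOrder i j
P₂-π i j with ℕ.<-cmp i j
... | tri≈ _ refl _ = trans (P₂-true {π i} ℕ.≤-refl ℕ.≤-refl) (sym (Natural.reflexive pathOrder-natural i))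
... | tri> _ _ j<i = trans (P₂-false reversed) (sym (Natural.upward pathOrder-natural j<i))
  where
  reversed : (π j < π i) ⊎ (σ (π j) < σ (π i))
  reversed with isEven i in eq
  ... | true  = inj₂ (ℕ.≤-trans (s≤s (proj₂ (σπ-bounds j))) (ℕ.≤-trans (s≤s j<i) (ℕ.≤-reflexive (sym (σπ-even i eq)))))
  ... | false = inj₁ (ℕ.≤-trans (s≤s (proj₂ (π-bounds j))) (ℕ.≤-trans (s≤s j<i) (ℕ.≤-reflexive (sym (π-odd i eq)))))
... | tri< i<j _ _ with ℕ.m≤n⇒m<n∨m≡n i<j
...   | inj₁ far = trans
        (P₂-true (ℕ.≤-trans (proj₂ (π-bounds i)) (ℕ.≤-trans (ℕ.∸-monoˡ-≤ 1 far) (proj₁ (π-bounds j))))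
                 (ℕ.≤-trans (proj₂ (σπ-bounds i)) (ℕ.≤-trans (ℕ.∸-monoˡ-≤ 1 far) (proj₁ (σπ-bounds j)))))
        (sym (pathOrder-far far))
...   | inj₂ refl = trans (P₂-false (crossed (isEven i) refl)) (sym (pathOrder-near i))
  where
  crossed : ∀ b → isEven i ≡ b → (π (suc i) < π i) ⊎ (σ (π (suc i)) < σ (π i))
  crossed true eq  = inj₂ (ℕ.≤-reflexive (trans (cong suc (σπ-odd (suc i) (cong not eq))) (sym (σπ-even i eq))))
  crossed false eq = inj₁ (ℕ.≤-reflexive (trans (cong suc (π-even (suc i) (cong not eq))) (sym (π-odd i eq))))

ageP₂≐age-pathOrder : Age P₂ ≐ Age pathOrder
ageP₂≐age-pathOrder =
  age-reindex P₂ pathOrder π π-injective (λ i j → trans (sym (cong₂ P₂ (π-involutive i) (π-involutive j))) (P₂-π (π i) (π j))) ,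
  age-reindex pathOrder P₂ π π-injective (λ i j → sym (P₂-π i j))
  where
  π-injective : Injective π
  π-injective = leftInverse⇒injective π π-involutive

-- Neither family embeds in the other

P∞-true : ∀ {i j} → P∞ i j ≡ true → (suc i ≡ j) ⊎ (suc j ≡ i)
P∞-true {i} {j} adj with ℕ.<-cmp i j
... | tri≈ _ refl _ = contradiction (trans (sym adj) (P∞-irrefl i)) λ ()
... | tri< i<j _ _ with ℕ.m≤n⇒m<n∨m≡n i<j
...   | inj₁ far = contradiction (trans (sym adj) (P∞-far far)) λ ()
...   | inj₂ eq  = inj₁ eq
P∞-true {i} {j} adj | tri> _ _ j<i with ℕ.m≤n⇒m<n∨m≡n j<i
...   | inj₁ far = contradiction (trans (sym adj) (P∞-far′ far)) λ ()
...   | inj₂ eq  = inj₂ eq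

-- Degrees in a path are at most two, while the half graph has a vertex with three neighbours.
half⊀path : Escapes (restrict half ∘ double) (restrict P∞ ∘ (4 +_))
half⊀path = 3 , λ n (f , f-inj , f-rel) →
  let sep : ∀ i j → i ≢ j → toℕ (f i) ≢ toℕ (f j)
      sep i j i≢j eq = i≢j (f-inj i j (Fin.toℕ-injective eq))
      nbr : ∀ j → half 0 (toℕ j) ≡ true → (suc (toℕ (f o)) ≡ toℕ (f j)) ⊎ (suc (toℕ (f j)) ≡ toℕ (f o))
      nbr j adj = P∞-true (trans (sym (f-rel o j)) adj)
  in crowded (nbr a refl) (nbr b refl) (nbr c refl) (sep a b λ ()) (sep a c λ ()) (sep b c λ ())
  where
  o a b c : Fin 6
  o = # 0
  a = # 1
  b = # 3
  c = # 5

  crowded : ∀ {k x y z} → (suc k ≡ x) ⊎ (suc x ≡ k) → (suc k ≡ y) ⊎ (suc y ≡ k) → (suc k ≡ z) ⊎ (suc z ≡ k) →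
    x ≢ y → x ≢ z → y ≢ z → ⊥
  crowded (inj₁ p) (inj₁ q) _ x≢y _ _ = x≢y (trans (sym p) q)
  crowded (inj₂ p) (inj₂ q) _ x≢y _ _ = x≢y (ℕ.suc-injective (trans p (sym q)))
  crowded (inj₁ p) (inj₂ _) (inj₁ r) _ x≢z _ = x≢z (trans (sym p) r)
  crowded (inj₁ _) (inj₂ q) (inj₂ r) _ _ y≢z = y≢z (ℕ.suc-injective (trans q (sym r)))
  crowded (inj₂ _) (inj₁ q) (inj₁ r) _ _ y≢z = y≢z (trans (sym q) r)
  crowded (inj₂ p) (inj₁ _) (inj₂ r) _ x≢z _ = x≢z (ℕ.suc-injective (trans p (sym r)))

record HalfEdge (e o : ℕ) : Set where
  constructor edge
  field
    even    : isEven e ≡ true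
    odd     : isEven o ≡ false
    ordered : e < o

half-true : ∀ {i j} → half i j ≡ true → HalfEdge i j ⊎ HalfEdge j i
half-true {i} {j} adj with ℕ.<-cmp i j
... | tri≈ _ refl _ = contradiction (trans (sym adj) (half-sameParity i i refl)) λ ()
... | tri< i<j _ _ with isEven i in ei | isEven j in ej | trans (sym (half-< i<j)) adj
...   | true | false | _ = inj₁ (edge ei ej i<j)
half-true {i} {j} adj | tri> _ _ j<i with isEven j in ej | isEven i in ei | trans (sym (half-> j<i)) adj
...   | true | false | _ = inj₂ (edge ej ei j<i)

-- The half graph has no two independent edges, while a path on five vertices has.
path⊀half : Escapes (restrict P∞ ∘ (4 +_)) (restrict half ∘ double)
path⊀half = 1 , λ n (f , f-inj , f-rel) →
  let adj : ∀ i j → P∞ (toℕ i) (toℕ j) ≡ true → HalfEdge (toℕ (f i)) (toℕ (f j)) ⊎ HalfEdge (toℕ (f j)) (toℕ (f i))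
      adj i j eq = half-true (trans (sym (f-rel i j)) eq)
      non : ∀ i j → P∞ (toℕ i) (toℕ j) ≡ false → half (toℕ (f i)) (toℕ (f j)) ≡ false
      non i j eq = trans (sym (f-rel i j)) eq
  in clash (adj a b refl) (adj c d refl)
       (non a c refl) (non a d refl) (non b c refl) (non b d refl)
       (non c a refl) (non d a refl) (non c b refl) (non d b refl)
  where
  a b c d : Fin 5
  a = # 0
  b = # 1
  c = # 3
  d = # 4

  below : ∀ {e o e′ o′} → HalfEdge e o → HalfEdge e′ o′ → half e o′ ≡ false → o′ < e
  below {e} {o′ = o′} (edge ev _ _) (edge _ od′ _) non with ℕ.<-cmp e o′
  ... | tri< e<o′ _ _  = contradiction (trans (sym non) (half-edge ev od′ e<o′)) λ ()
  ... | tri≈ _ refl _  = contradiction (trans (sym ev) od′) λ ()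
  ... | tri> _ _ o′<e  = o′<e

  -- The two missing cross edges close the cycle `e < o < e′ < o′ < e`.
  independent : ∀ {e o e′ o′} → HalfEdge e o → HalfEdge e′ o′ → half e o′ ≡ false → half e′ o ≡ false → ⊥
  independent E E′ non non′ = ℕ.<-irrefl refl
    (ℕ.<-trans (HalfEdge.ordered E) (ℕ.<-trans (below E′ E non′) (ℕ.<-trans (HalfEdge.ordered E′) (below E E′ non))))

  clash : ∀ {a b c d} → HalfEdge a b ⊎ HalfEdge b a → HalfEdge c d ⊎ HalfEdge d c →
    half a c ≡ false → half a d ≡ false → half b c ≡ false → half b d ≡ false →
    half c a ≡ false → half d a ≡ false → half c b ≡ false → half d b ≡ false → ⊥
  clash (inj₁ E) (inj₁ F) ac ad bc bd ca da cb db = independent E F ad cb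
  clash (inj₁ E) (inj₂ F) ac ad bc bd ca da cb db = independent E F ac db
  clash (inj₂ E) (inj₁ F) ac ad bc bd ca da cb db = independent E F bd ca
  clash (inj₂ E) (inj₂ F) ac ad bc bd ca da cb db = independent E F bc da

-- Passing between the posets and their incomparability graphs

inc-P₁ : ∀ n i j → rel (inc (restrict P₁ n)) i j ≡ rel (restrict half n) i j
inc-P₁ = inc-restrict P₁

inc-path : ∀ n i j → rel (inc (restrict pathOrder n)) i j ≡ rel (restrict P∞ n) i j
inc-path n i j = trans (inc-restrict pathOrder n i j) (inc-pathOrder (toℕ i) (toℕ j))

-- By `inc-mono` an embedding of posets is also one of incomparability graphs, so both separations
-- are inherited from the graphs.
inc-escapes : ∀ {A B A′ B′ : ℕ → FinStr} → (∀ n → Embeds (A′ n) (inc (A n))) → (∀ n → Embeds (inc (B n)) (B′ n)) →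
  Escapes A′ B′ → Escapes A B
inc-escapes {A} {B} {A′} {B′} A′≤A B≤B′ (k , A′⊀B′) = k , λ n A≤B → A′⊀B′ n
  (Embeds-trans (A′ k) (inc (A k)) (B′ n) (A′≤A k)
    (Embeds-trans (inc (A k)) (inc (B n)) (B′ n) (inc-mono {A k} {B n} A≤B) (B≤B′ n)))

halfPosets pathPosets halfGraphs pathGraphs : ℕ → FinStr
halfPosets = restrict P₁ ∘ double
pathPosets = restrict pathOrder ∘ (4 +_)
halfGraphs = restrict half ∘ double
pathGraphs = restrict P∞ ∘ (4 +_)

halfPoset⊀path : Escapes halfPosets pathPosets
halfPoset⊀path = inc-escapes {halfPosets} {pathPosets} {halfGraphs} {pathGraphs}
  (λ n → Embeds-pointwise λ i j → sym (inc-P₁ (double n) i j)) (λ n → Embeds-pointwise (inc-path (4 + n))) half⊀path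

pathPoset⊀half : Escapes pathPosets halfPosets
pathPoset⊀half = inc-escapes {pathPosets} {halfPosets} {pathGraphs} {halfGraphs}
  (λ n → Embeds-pointwise λ i j → sym (inc-path (4 + n) i j)) (λ n → Embeds-pointwise (inc-P₁ (double n))) path⊀half

halfGraph-family : PrimeFamily halfGraphs
halfGraph-family = record
  { mono = λ m≤n → restrict-mono half (double-mono m≤n) ; prime = half-prime ; large = n≤double }

pathGraph-family : PrimeFamily pathGraphs
pathGraph-family = record
  { mono = λ m≤n → restrict-mono P∞ (ℕ.+-monoʳ-≤ 4 m≤n) ; prime = path-prime ; large = λ n → ℕ.m≤n+m n 4 }

halfPoset-family : PrimeFamily halfPosets
halfPoset-family = record
  { mono = λ m≤n → restrict-mono P₁ (double-mono m≤n)
  ; prime = λ n → inc-prime⇒prime (prime-resp (λ i j → sym (inc-P₁ (double n) i j)) (half-prime n))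
  ; large = n≤double }

pathPoset-family : PrimeFamily pathPosets
pathPoset-family = record
  { mono = λ m≤n → restrict-mono pathOrder (ℕ.+-monoʳ-≤ 4 m≤n)
  ; prime = λ n → inc-prime⇒prime (prime-resp (λ i j → sym (inc-path (4 + n) i j)) (path-prime n))
  ; large = λ n → ℕ.m≤n+m n 4 }

-- Posets of width at most two

module Poset {P : FinStr} (poset : IsPoset P) where
  open IsPoset poset

  V : Set
  V = Fin (size P)

  -- Strict order and incomparability each fix both entries of `rel P`, so a comparison directly
  -- supplies the two equations of a module.
  _⊑_ _⊏_ _∥_ : V → V → Set
  x ⊑ y = rel P x y ≡ true
  x ⊏ y = x ⊑ y × (rel P y x ≡ false)
  x ∥ y = Incomp P x y

  data Comparison (x y : V) : Set where
    below  : x ⊏ y → Comparison x y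
    equal  : x ≡ y → Comparison x y
    above  : y ⊏ x → Comparison x y
    beside : x ∥ y → Comparison x y

  compare : ∀ x y → Comparison x y
  compare x y with rel P x y in xy | rel P y x in yx
  ... | true  | true  = equal (antisym x y xy yx)
  ... | true  | false = below (xy , yx)
  ... | false | true  = above (yx , xy)
  ... | false | false = beside (xy , yx)

  _∥?_ : ∀ x y → Dec (x ∥ y)
  x ∥? y = (rel P x y Bool.≟ false) ×-dec (rel P y x Bool.≟ false)

  ⊑-trans : ∀ {x y z} → x ⊑ y → y ⊑ z → x ⊑ z
  ⊑-trans = trans′ _ _ _

  ⊏-⊑-trans : ∀ {x y z} → x ⊏ y → y ⊑ z → x ⊏ z
  ⊏-⊑-trans {x} {y} {z} (xy , yx) yz = ⊑-trans xy yz , Bool.¬-not λ zx → Bool.not-¬ yx (⊑-trans yz zx)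

  ⊑-⊏-trans : ∀ {x y z} → x ⊑ y → y ⊏ z → x ⊏ z
  ⊑-⊏-trans {x} {y} {z} xy (yz , zy) = ⊑-trans xy yz , Bool.¬-not λ zx → Bool.not-¬ zy (⊑-trans zx xy)

  ⊏-trans : ∀ {x y z} → x ⊏ y → y ⊏ z → x ⊏ z
  ⊏-trans x⊏y (yz , _) = ⊏-⊑-trans x⊏y yz

  ⊏-irrefl : ∀ {x} → ¬ x ⊏ x
  ⊏-irrefl (xx , xx′) = Bool.not-¬ xx′ xx

  ∥-sym : ∀ {x y} → x ∥ y → y ∥ x
  ∥-sym = swap

  ∥-irrefl : ∀ {x} → ¬ x ∥ x
  ∥-irrefl {x} (xx , _) = Bool.not-¬ xx (refl′ x)

  ∥⇒¬⊏ : ∀ {x y} → x ∥ y → ¬ x ⊏ y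
  ∥⇒¬⊏ (xy , _) (xy′ , _) = Bool.not-¬ xy xy′

  ∥⇒¬⊐ : ∀ {x y} → x ∥ y → ¬ y ⊏ x
  ∥⇒¬⊐ = ∥⇒¬⊏ ∘ ∥-sym

  -- Pairs with `s < t` suffice, as `Natural` settles the others. Injectivity follows because
  -- `rel P (f t) (f s)` is then false, whereas `rel P` is reflexive.
  embed-increasing : ∀ {R} → Natural R → ∀ {n} (f : Fin n → V) →
    (∀ {s t} → toℕ s < toℕ t → R (toℕ s) (toℕ t) ≡ true → f s ⊏ f t) →
    (∀ {s t} → toℕ s < toℕ t → R (toℕ s) (toℕ t) ≡ false → f s ∥ f t) →
    Embeds (restrict R n) P
  embed-increasing {R} natural f comparable incomparable = f , injective , preserves
    where
    open Natural natural

    increasing : ∀ {s t} → toℕ s < toℕ t → (rel P (f s) (f t) ≡ R (toℕ s) (toℕ t)) × (rel P (f t) (f s) ≡ false)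
    increasing {s} {t} s<t with R (toℕ s) (toℕ t) in eq
    ... | true  = comparable s<t eq
    ... | false = incomparable s<t eq

    preserves : ∀ s t → R (toℕ s) (toℕ t) ≡ rel P (f s) (f t)
    preserves s t with ℕ.<-cmp (toℕ s) (toℕ t)
    ... | tri< s<t _ _ = sym (proj₁ (increasing s<t))
    ... | tri> _ _ t<s = trans (upward t<s) (sym (proj₂ (increasing t<s)))
    ... | tri≈ _ eq _ with Fin.toℕ-injective eq
    ...   | refl = trans (reflexive (toℕ s)) (sym (refl′ (f s)))

    ordered-distinct : ∀ {s t} → toℕ s < toℕ t → f s ≢ f t
    ordered-distinct {s} {t} s<t eq = true-false⇒≢ (refl′ (f s))
      (trans (cong (λ v → rel P v (f s)) eq) (proj₂ (increasing s<t))) refl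

    injective : Injective f
    injective s t eq with ℕ.<-cmp (toℕ s) (toℕ t)
    ... | tri< s<t _ _ = contradiction eq (ordered-distinct s<t)
    ... | tri≈ _ e _   = Fin.toℕ-injective e
    ... | tri> _ _ t<s = contradiction (sym eq) (ordered-distinct t<s)

  -- Pairs (a , b), (a′ , b′), … ordered by Ladder interleave to a copy of P₁.
  record Ladder (p q : V × V) : Set where
    constructor ladder
    field
      a⊏a′ : proj₁ p ⊏ proj₁ q
      b⊏b′ : proj₂ p ⊏ proj₂ q
      b⊏a′ : proj₂ p ⊏ proj₁ q
      a∥b′ : proj₁ p ∥ proj₂ q

  flatten : (ps : List (V × V)) → Fin (double (length ps)) → V
  flatten (p ∷ ps) zero          = proj₁ p
  flatten (p ∷ ps) (suc zero)    = proj₂ p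
  flatten (p ∷ ps) (suc (suc i)) = flatten ps i

  -- First components land on even positions and second ones on odd positions. By `P₁-≤` the
  -- incomparable pairs must be those with an even position before an odd one: the rungs within a
  -- pair, and `a∥b′` across pairs.
  ladder⇒half : ∀ ps → All (λ p → proj₁ p ∥ proj₂ p) ps → AllPairs Ladder ps →
    Embeds (halfPosets (length ps)) P
  ladder⇒half ps rungs ladders =
    embed-increasing P₁-natural (flatten ps)
      (λ s<t eq → comparable ps ladders s<t (Bool.not-injective (trans (sym (P₁-≤ (ℕ.<⇒≤ s<t))) eq)))
      (λ s<t eq → incomparable ps rungs ladders s<t (Bool.not-injective (trans (sym (P₁-≤ (ℕ.<⇒≤ s<t))) eq)))
    where
    crossing : ℕ → ℕ → Bool
    crossing s t = isEven s ∧ not (isEven t)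

    crossing-shift : ∀ s t → crossing (suc (suc s)) (suc (suc t)) ≡ crossing s t
    crossing-shift s t = cong₂ (λ b c → b ∧ not c) (Bool.not-involutive (isEven s)) (Bool.not-involutive (isEven t))

    evenly : ∀ {Q R : V → Set} ps → All (λ p → Q (proj₁ p) × R (proj₂ p)) ps → ∀ t →
      (isEven (toℕ t) ≡ true → Q (flatten ps t)) × (isEven (toℕ t) ≡ false → R (flatten ps t))
    evenly (p ∷ ps) ((q , r) ∷ _) zero          = (λ _ → q) , λ ()
    evenly (p ∷ ps) ((q , r) ∷ _) (suc zero)    = (λ ()) , λ _ → r
    evenly (p ∷ ps) (_ ∷ all) (suc (suc t)) with evenly ps all t
    ... | ev , od = ev ∘ trans (sym (Bool.not-involutive _)) , od ∘ trans (sym (Bool.not-involutive _))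

    even-tail : ∀ {n} (t : Fin n) → crossing 0 (suc (suc (toℕ t))) ≡ false → isEven (toℕ t) ≡ true
    even-tail t eq = trans (sym (Bool.not-involutive _)) (Bool.not-injective eq)

    odd-tail : ∀ {n} (t : Fin n) → crossing 0 (suc (suc (toℕ t))) ≡ true → isEven (toℕ t) ≡ false
    odd-tail t eq = trans (sym (Bool.not-involutive _)) (Bool.not-injective eq)

    always : ∀ {Q : V → Set} ps → All (λ p → Q (proj₁ p) × Q (proj₂ p)) ps → ∀ t → Q (flatten ps t)
    always ps all t with isEven (toℕ t) in eq
    ... | true  = proj₁ (evenly ps all t) eq
    ... | false = proj₂ (evenly ps all t) eq

    comparable : ∀ ps → AllPairs Ladder ps → ∀ {s t} → toℕ s < toℕ t → crossing (toℕ s) (toℕ t) ≡ false →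
      flatten ps s ⊏ flatten ps t
    comparable (p ∷ ps) (l ∷ _) {zero} {suc (suc t)} _ eq =
      -- The predicate `λ _ → V` is a filler for the odd positions, witnessed by any vertex at hand.
      proj₁ (evenly {_ ⊏_} {λ _ → V} ps (All.map (λ {q} L → Ladder.a⊏a′ L , proj₁ q) l) t) (even-tail t eq)
    comparable (p ∷ ps) (l ∷ _) {suc zero} {suc (suc t)} _ _ =
      always ps (All.map (λ L → Ladder.b⊏a′ L , Ladder.b⊏b′ L) l) t
    comparable (p ∷ ps) _ {suc zero} {suc zero} (s≤s ()) _
    comparable (p ∷ ps) (_ ∷ ls) {suc (suc s)} {suc (suc t)} (s≤s (s≤s s<t)) eq =
      comparable ps ls s<t (trans (sym (crossing-shift (toℕ s) (toℕ t))) eq)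

    incomparable : ∀ ps → All (λ p → proj₁ p ∥ proj₂ p) ps → AllPairs Ladder ps →
      ∀ {s t} → toℕ s < toℕ t → crossing (toℕ s) (toℕ t) ≡ true → flatten ps s ∥ flatten ps t
    incomparable (p ∷ ps) (r ∷ _) _ {zero} {suc zero} _ _ = r
    incomparable (p ∷ ps) _ (l ∷ _) {zero} {suc (suc t)} _ eq =
      proj₂ (evenly {λ _ → V} {_ ∥_} ps (All.map (λ {q} L → proj₁ q , Ladder.a∥b′ L) l) t) (odd-tail t eq)
    incomparable (p ∷ ps) (_ ∷ rs) (_ ∷ ls) {suc (suc s)} {suc (suc t)} (s≤s (s≤s s<t)) eq =
      incomparable ps rs ls s<t (trans (sym (crossing-shift (toℕ s) (toℕ t))) eq)

  -- Sorting chains, and neighbourhoods in the incomparability graph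

  Comparable : V → V → Set
  Comparable x y = x ⊏ y ⊎ y ⊏ x

  insert : ∀ x {ys} → All (Comparable x) ys → AllPairs _⊏_ ys → ∃ λ zs → AllPairs _⊏_ zs × (zs ↭ x ∷ ys)
  insert x [] [] = x ∷ [] , [] ∷ [] , ↭-refl
  insert x {y ∷ ys} (inj₁ x⊏y ∷ _) (y⊏ys ∷ sorted) =
    x ∷ y ∷ ys , (x⊏y ∷ All.map (⊏-trans x⊏y) y⊏ys) ∷ y⊏ys ∷ sorted , ↭-refl
  insert x {y ∷ ys} (inj₂ y⊏x ∷ cmp) (y⊏ys ∷ sorted) with insert x cmp sorted
  ... | zs , sorted′ , perm = y ∷ zs , All-resp-↭ (↭-sym perm) (y⊏x ∷ y⊏ys) ∷ sorted′ ,
        ↭-trans (↭-prep y perm) (↭-swap y x ↭-refl)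

  sortChain : ∀ {xs} → AllPairs Comparable xs → ∃ λ ys → AllPairs _⊏_ ys × (ys ↭ xs)
  sortChain [] = [] , [] , ↭-refl
  sortChain {x ∷ _} (cmp ∷ rest) with sortChain rest
  ... | ys , sorted , perm with insert x (All-resp-↭ (↭-sym perm) cmp) sorted
  ... | zs , sorted′ , perm′ = zs , sorted′ , ↭-trans perm′ (↭-prep x perm)

  neighbours : V → List V
  neighbours v = filter (v ∥?_) (allFin (size P))

  ∈-neighbours⁺ : ∀ {v u} → v ∥ u → u ∈ neighbours v
  ∈-neighbours⁺ {v} {u} = ∈-filter⁺ (v ∥?_) (∈-allFin u)

  ∈-neighbours⁻ : ∀ {v u} → u ∈ neighbours v → v ∥ u
  ∈-neighbours⁻ {v} u∈ = proj₂ (∈-filter⁻ (v ∥?_) {xs = allFin (size P)} u∈)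

  module PrimeWidth2 (width : Width≤2 P) (prime : Prime P) (3<size : 3 < size P) where

    Separates : V → V → V → Set
    Separates w c c′ = w ≢ c × w ≢ c′ × ¬ ((rel P w c ≡ rel P w c′) × (rel P c w ≡ rel P c′ w))

    -- Without a separator, `c` and `c′` would form a two-element module, which is nontrivial since
    -- there are more than three vertices.
    separator : ∀ {c c′} → c ≢ c′ → ∃ λ w → Separates w c c′
    separator {c} {c′} c≢c′ = decide (Fin.any? separates?)
      where
      separates? : ∀ w → Dec (Separates w c c′)
      separates? w = ¬? (w ≟ c) ×-dec ¬? (w ≟ c′)
        ×-dec ¬? ((rel P w c Bool.≟ rel P w c′) ×-dec (rel P c w Bool.≟ rel P c′ w))

      decide : Dec (∃ λ w → Separates w c c′) → ∃ λ w → Separates w c c′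
      decide (yes found) = found
      decide (no none) with prime-dec prime {λ u → u ≡ c ⊎ u ≡ c′} (λ u → (u ≟ c) ⊎-dec (u ≟ c′)) pair-module
        where
        same : ∀ {w} → ¬ (w ≡ c ⊎ w ≡ c′) → (rel P w c ≡ rel P w c′) × (rel P c w ≡ rel P c′ w)
        same {w} w∉ = decidable-stable ((rel P w c Bool.≟ rel P w c′) ×-dec (rel P c w Bool.≟ rel P c′ w))
          λ differs → none (w , w∉ ∘ inj₁ , w∉ ∘ inj₂ , differs)

        pair-module : ∀ {v a a′} → ¬ (v ≡ c ⊎ v ≡ c′) → a ≡ c ⊎ a ≡ c′ → a′ ≡ c ⊎ a′ ≡ c′ →
          (rel P v a ≡ rel P v a′) × (rel P a v ≡ rel P a′ v)
        pair-module v∉ (inj₁ refl) (inj₁ refl) = refl , refl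
        pair-module v∉ (inj₁ refl) (inj₂ refl) = same v∉
        pair-module v∉ (inj₂ refl) (inj₁ refl) = sym (proj₁ (same v∉)) , sym (proj₂ (same v∉))
        pair-module v∉ (inj₂ refl) (inj₂ refl) = refl , refl
      ... | inj₁ sub = contradiction (sub (inj₁ refl) (inj₂ refl)) c≢c′
      ... | inj₂ all = contradiction (covering⇒size≤ (c ∷ c′ ∷ []) λ u → [ here , there ∘ here ]′ (all u))
            (ℕ.<⇒≱ (ℕ.<-trans ℕ.≤-refl 3<size))

    -- A vertex of large incomparability degree

    module HighDegree (v : V) where

      comparable : ∀ {x y} → v ∥ x → v ∥ y → x ≢ y → Comparable x y
      comparable {x} {y} v∥x v∥y x≢y with compare x y
      ... | below x⊏y  = inj₁ x⊏y
      ... | equal x≡y  = contradiction x≡y x≢y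
      ... | above y⊏x  = inj₂ y⊏x
      ... | beside x∥y = ⊥-elim (width v x y v∥x x∥y v∥y)

      -- The two ways in which some w separates consecutive members of the chain of neighbours of v.
      LowAt HighAt : V → V → Set
      LowAt e w  = (∀ {u} → v ∥ u → e ⊏ u → w ⊏ u) × (∀ {u} → v ∥ u → u ⊑ e → w ∥ u)
      HighAt e w = (∀ {u} → v ∥ u → u ⊏ e → u ⊏ w) × (∀ {u} → v ∥ u → e ⊑ u → w ∥ u)

      -- A separator `w` turns out to be incomparable to exactly one of `c` and `c′`. Width two then
      -- forces `w` to be comparable to `v`, and this comparison decides how `w` relates to the rest
      -- of the chain.
      consecutive : ∀ {c c′} → v ∥ c → v ∥ c′ → c ⊏ c′ → (∀ {u} → v ∥ u → c ⊏ u → c′ ⊑ u) →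
        ∃ (LowAt c) ⊎ ∃ (HighAt c′)
      consecutive {c} {c′} v∥c v∥c′ c⊏c′ next with separator {c} {c′} (λ eq → ⊏-irrefl (subst (c ⊏_) (sym eq) c⊏c′))
      ... | w , w≢c , w≢c′ , differs with compare w c | compare w c′
      ... | equal w≡c | _ = contradiction w≡c w≢c
      ... | _ | equal w≡c′ = contradiction w≡c′ w≢c′
      ... | below w⊏c | _ = contradiction (agree w⊏c (⊏-trans w⊏c c⊏c′)) differs
        where
        agree : w ⊏ c → w ⊏ c′ → (rel P w c ≡ rel P w c′) × (rel P c w ≡ rel P c′ w)
        agree (p , q) (p′ , q′) = trans p (sym p′) , trans q (sym q′)
      ... | beside (p , q) | beside (p′ , q′) = contradiction (trans p (sym p′) , trans q (sym q′)) differs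
      ... | _ | above c′⊏w = contradiction (agree (⊏-trans c⊏c′ c′⊏w) c′⊏w) differs
        where
        agree : c ⊏ w → c′ ⊏ w → (rel P w c ≡ rel P w c′) × (rel P c w ≡ rel P c′ w)
        agree (p , q) (p′ , q′) = trans q (sym q′) , trans p (sym p′)
      -- Nothing lies strictly between: if `w` is comparable to `v`, then so is `c` or `c′`; if not,
      -- `w` belongs to the chain and contradicts `next`.
      ... | above c⊏w | below w⊏c′ = ⊥-elim (between (compare v w))
        where
        between : Comparison v w → ⊥
        between (below v⊏w)  = ∥⇒¬⊏ v∥c′ (⊏-trans v⊏w w⊏c′)
        between (equal refl) = ∥⇒¬⊐ v∥c c⊏w
        between (above w⊏v)  = ∥⇒¬⊐ v∥c (⊏-trans c⊏w w⊏v)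
        between (beside v∥w) = ⊏-irrefl (⊏-⊑-trans w⊏c′ (next v∥w c⊏w))
      ... | beside w∥c | below w⊏c′ = inj₁ (w , (λ v∥u c⊏u → ⊏-⊑-trans w⊏c′ (next v∥u c⊏u)) , initial)
        where
        w⊏v : w ⊏ v
        w⊏v with compare w v
        ... | below w⊏v  = w⊏v
        ... | equal refl = contradiction w⊏c′ (∥⇒¬⊏ v∥c′)
        ... | above v⊏w  = contradiction (⊏-trans v⊏w w⊏c′) (∥⇒¬⊏ v∥c′)
        ... | beside w∥v = ⊥-elim (width w v c w∥v v∥c w∥c)

        initial : ∀ {u} → v ∥ u → u ⊑ c → w ∥ u
        initial {u} v∥u u⊑c with compare w u
        ... | below w⊏u  = contradiction (⊏-⊑-trans w⊏u u⊑c) (∥⇒¬⊏ w∥c)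
        ... | equal refl = contradiction w⊏v (∥⇒¬⊐ v∥u)
        ... | above u⊏w  = contradiction (⊏-trans u⊏w w⊏v) (∥⇒¬⊐ v∥u)
        ... | beside w∥u = w∥u
      ... | above c⊏w | beside w∥c′ = inj₂ (w , (λ v∥u u⊏c′ → ⊑-⊏-trans (previous v∥u u⊏c′) c⊏w) , final)
        where
        v⊏w : v ⊏ w
        v⊏w with compare v w
        ... | below v⊏w  = v⊏w
        ... | equal refl = contradiction c⊏w (∥⇒¬⊐ v∥c)
        ... | above w⊏v  = contradiction (⊏-trans c⊏w w⊏v) (∥⇒¬⊐ v∥c)
        ... | beside v∥w = ⊥-elim (width v w c′ v∥w w∥c′ v∥c′)

        previous : ∀ {u} → v ∥ u → u ⊏ c′ → u ⊑ c
        previous {u} v∥u u⊏c′ with compare u c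
        ... | below u⊏c  = proj₁ u⊏c
        ... | equal refl = refl′ u
        ... | above c⊏u  = ⊥-elim (⊏-irrefl (⊏-⊑-trans u⊏c′ (next v∥u c⊏u)))
        ... | beside u∥c = ⊥-elim (width v u c v∥u u∥c v∥c)

        final : ∀ {u} → v ∥ u → c′ ⊑ u → w ∥ u
        final {u} v∥u c′⊑u with compare w u
        ... | below w⊏u  = contradiction (⊏-trans v⊏w w⊏u) (∥⇒¬⊏ v∥u)
        ... | equal refl = contradiction v⊏w (∥⇒¬⊏ v∥u)
        ... | above u⊏w  = contradiction (⊑-⊏-trans c′⊑u u⊏w) (∥⇒¬⊐ w∥c′)
        ... | beside w∥u = w∥u

      -- Both separators are incomparable to `c`, so by width two they are comparable to each other;
      -- `w′ ⊏ w` or equality would put `w′` below `e`.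
      low-ladder : ∀ {c w e w′} → v ∥ c → v ∥ e → c ⊏ e → LowAt c w → LowAt e w′ → Ladder (c , w) (e , w′)
      low-ladder {c} {w} {e} {w′} v∥c v∥e c⊏e (up , down) (up′ , down′) =
        ladder c⊏e w⊏w′ (up v∥e c⊏e) (∥-sym (down′ v∥c (proj₁ c⊏e)))
        where
        w′∥e : w′ ∥ e
        w′∥e = down′ v∥e (refl′ e)

        w⊏w′ : w ⊏ w′
        w⊏w′ with compare w w′
        ... | below w⊏w′  = w⊏w′
        ... | equal refl  = contradiction (up v∥e c⊏e) (∥⇒¬⊏ w′∥e)
        ... | above w′⊏w  = contradiction (⊏-trans w′⊏w (up v∥e c⊏e)) (∥⇒¬⊏ w′∥e)
        ... | beside w∥w′ = ⊥-elim (width w w′ c w∥w′ (down′ v∥c (proj₁ c⊏e)) (down v∥c (refl′ c)))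

      -- Dual to `low-ladder`. The separator now comes first in its pair, since it is the one
      -- incomparable to all later chain members.
      high-ladder : ∀ {e w e′ w′} → v ∥ e → v ∥ e′ → e ⊏ e′ → HighAt e w → HighAt e′ w′ → Ladder (w , e) (w′ , e′)
      high-ladder {e} {w} {e′} {w′} v∥e v∥e′ e⊏e′ (down , up) (down′ , up′) =
        ladder w⊏w′ e⊏e′ (down′ v∥e e⊏e′) (up v∥e′ (proj₁ e⊏e′))
        where
        w∥e : w ∥ e
        w∥e = up v∥e (refl′ e)

        w⊏w′ : w ⊏ w′
        w⊏w′ with compare w w′
        ... | below w⊏w′  = w⊏w′
        ... | equal refl  = contradiction (down′ v∥e e⊏e′) (∥⇒¬⊐ w∥e)
        ... | above w′⊏w  = contradiction (⊏-trans (down′ v∥e e⊏e′) w′⊏w) (∥⇒¬⊐ w∥e)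
        ... | beside w∥w′ = ⊥-elim (width w w′ e′ w∥w′ (up′ v∥e′ (refl′ e′)) (up v∥e′ (proj₁ e⊏e′)))

      -- The `n` gaps of the chain above `c` are distributed over two ladders. A low separator is
      -- filed at the lower end of its gap, possibly `c` itself, and a high one at the upper end;
      -- hence `c ⊑ e` in one list and `c ⊏ e` in the other.
      record Ladders (c : V) (n : ℕ) : Set where
        field
          lows highs   : List (V × V)
          count        : n ≡ length lows + length highs
          low-at       : All (λ (e , w) → c ⊑ e × v ∥ e × LowAt e w) lows
          high-at      : All (λ (w , e) → c ⊏ e × v ∥ e × HighAt e w) highs
          low-ladders  : AllPairs Ladder lows
          high-ladders : AllPairs Ladder highs

      -- The last hypothesis makes neighbours in the list consecutive among all vertices
      -- incomparable to `v`, as `consecutive` requires.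
      ladders : ∀ c rest → AllPairs _⊏_ (c ∷ rest) → All (v ∥_) (c ∷ rest) → (∀ {u} → v ∥ u → c ⊏ u → u ∈ rest) →
        Ladders c (length rest)
      ladders c [] _ _ _ = record
        { lows = [] ; highs = [] ; count = refl ; low-at = [] ; high-at = [] ; low-ladders = [] ; high-ladders = [] }
      ladders c (c′ ∷ rest) ((c⊏c′ ∷ c⊏rest) ∷ c′⊏rest ∷ sorted) (v∥c ∷ v∥c′ ∷ v∥rest) complete = extend split
        where
        next : ∀ {u} → v ∥ u → c ⊏ u → c′ ⊑ u
        next v∥u c⊏u with complete v∥u c⊏u
        ... | here refl = refl′ _
        ... | there u∈  = proj₁ (All.lookup c′⊏rest u∈)

        split : ∃ (LowAt c) ⊎ ∃ (HighAt c′)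
        split = consecutive v∥c v∥c′ c⊏c′ next

        complete′ : ∀ {u} → v ∥ u → c′ ⊏ u → u ∈ rest
        complete′ v∥u c′⊏u with complete v∥u (⊏-trans c⊏c′ c′⊏u)
        ... | here refl = contradiction c′⊏u ⊏-irrefl
        ... | there u∈  = u∈

        open Ladders (ladders c′ rest (c′⊏rest ∷ sorted) (v∥c′ ∷ v∥rest) complete′)

        low-at′ : All (λ (e , w) → c ⊑ e × v ∥ e × LowAt e w) lows
        low-at′ = All.map (λ (c′⊑e , at) → ⊑-trans (proj₁ c⊏c′) c′⊑e , at) low-at

        high-at′ : All (λ (w , e) → c ⊏ e × v ∥ e × HighAt e w) highs
        high-at′ = All.map (λ (c′⊏e , at) → ⊏-trans c⊏c′ c′⊏e , at) high-at

        extend : ∃ (LowAt c) ⊎ ∃ (HighAt c′) → Ladders c (suc (length rest))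
        extend (inj₁ (w , low)) = record
          { lows = (c , w) ∷ lows ; highs = highs ; count = cong suc count
          ; low-at = (refl′ c , v∥c , low) ∷ low-at′ ; high-at = high-at′
          ; low-ladders = All.map (λ (c′⊑e , v∥e , low′) → low-ladder v∥c v∥e (⊏-⊑-trans c⊏c′ c′⊑e) low low′) low-at
              ∷ low-ladders
          ; high-ladders = high-ladders }
        extend (inj₂ (w , high)) = record
          { lows = lows ; highs = (w , c′) ∷ highs
          ; count = trans (cong suc count) (sym (ℕ.+-suc (length lows) (length highs)))
          ; low-at = low-at′ ; high-at = (c⊏c′ , v∥c′ , high) ∷ high-at′
          ; low-ladders = low-ladders
          ; high-ladders = All.map (λ (c′⊏e , v∥e , high′) → high-ladder v∥c′ v∥e c′⊏e high high′) high-at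
              ∷ high-ladders }

      chain-neighbours : AllPairs Comparable (neighbours v)
      chain-neighbours = pairs (All.tabulate ∈-neighbours⁻)
        (Unique.filter⁺ (v ∥?_) (Unique.allFin⁺ (size P)))
        where
        pairs : ∀ {xs} → All (v ∥_) xs → AllPairs _≢_ xs → AllPairs Comparable xs
        pairs [] [] = []
        pairs (v∥x ∷ v∥xs) (x≢xs ∷ rest) =
          All.zipWith (λ (v∥y , x≢y) → comparable v∥x v∥y x≢y) (v∥xs , x≢xs) ∷ pairs v∥xs rest

      -- More than `N + N` chain members leave at least `N + N` gaps, so one of the two ladders has
      -- at least `N` rungs.
      half-in-neighbourhood : ∀ {N} → N + N < length (neighbours v) → Embeds (halfPosets N) P
      half-in-neighbourhood {N} large with sortChain chain-neighbours
      ... | [] , _ , perm = contradiction (subst (N + N <_) (sym (↭-length perm)) large) λ ()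
      ... | c ∷ rest , c⊏rest ∷ sorted , perm =
        [ (λ N≤lows → grow lows N≤lows
            (ladder⇒half lows (All.map (λ {(e , _)} (_ , v∥e , _ , down) → ∥-sym (down v∥e (refl′ e))) low-at) low-ladders))
        , (λ N≤highs → grow highs N≤highs
            (ladder⇒half highs (All.map (λ {(_ , e)} (_ , v∥e , _ , up) → up v∥e (refl′ e)) high-at) high-ladders))
        ]′ (pigeonhole (length lows) (subst (N + N ≤_) count
              (ℕ.≤-pred (subst (N + N <_) (sym (↭-length perm)) large))))
        where
        complete : ∀ {u} → v ∥ u → c ⊏ u → u ∈ rest
        complete v∥u c⊏u with ∈-resp-↭ (↭-sym perm) (∈-neighbours⁺ v∥u)
        ... | here refl = contradiction c⊏u ⊏-irrefl
        ... | there u∈  = u∈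

        open Ladders (ladders c rest (c⊏rest ∷ sorted)
          (All-resp-↭ (↭-sym perm) (All.tabulate ∈-neighbours⁻)) complete)

        pigeonhole : ∀ l {h} → N + N ≤ l + h → N ≤ l ⊎ N ≤ h
        pigeonhole l N+N≤ with N ℕ.≤? l
        ... | yes N≤l = inj₁ N≤l
        ... | no N≰l  = inj₂ (ℕ.+-cancelˡ-≤ N _ _ (ℕ.≤-trans N+N≤ (ℕ.+-monoˡ-≤ _ (ℕ.≰⇒≥ N≰l))))

        grow : ∀ ps → N ≤ length ps → Embeds (halfPosets (length ps)) P → Embeds (halfPosets N) P
        grow ps N≤ = Embeds-trans (halfPosets N) (halfPosets (length ps)) P (PrimeFamily.mono halfPoset-family N≤)

    -- Bounded degree: balls and connectedness in the incomparability graph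

    open DecMembership (_≟_ {size P}) using (_∈?_)

    -- The ball of radius `k` about `r`, possibly with repetitions. Each step keeps `u` itself, so
    -- that balls grow with the radius.
    reach : V → ℕ → List V
    reach r zero    = r ∷ []
    reach r (suc k) = concatMap (λ u → u ∷ neighbours u) (reach r k)

    reach-suc : ∀ {r k u} → u ∈ reach r k → u ∈ reach r (suc k)
    reach-suc {r} {k} u∈ = ∈-concatMap⁺ (λ u → u ∷ neighbours u) {xs = reach r k} (Any.map here u∈)

    reach-≤ : ∀ {r j k u} → j ≤ k → u ∈ reach r j → u ∈ reach r k
    reach-≤ {j = j} {k} j≤k u∈ = go (ℕ.≤⇒≤′ j≤k)
      where
      go : ∀ {k} → j ≤′ k → _ ∈ reach _ k
      go ≤′-refl = u∈
      go (≤′-step {k} j≤k) = reach-suc {k = k} (go j≤k)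

    reach-∥ : ∀ {r k u v} → u ∈ reach r k → u ∥ v → v ∈ reach r (suc k)
    reach-∥ {r} {k} u∈ u∥v = ∈-concatMap⁺ (λ u → u ∷ neighbours u) {xs = reach r k}
      (Any.map (λ { refl → there (∈-neighbours⁺ u∥v) }) u∈)

    reach-pred : ∀ {r k v} → v ∈ reach r (suc k) → ∃ λ u → u ∈ reach r k × (v ≡ u ⊎ u ∥ v)
    reach-pred {r} {k} v∈ with find (∈-concatMap⁻ (λ u → u ∷ neighbours u) {xs = reach r k} v∈)
    ... | u , u∈ , here v≡u = u , u∈ , inj₁ v≡u
    ... | u , u∈ , there v∈N = u , u∈ , inj₂ (∈-neighbours⁻ v∈N)

    length-reach : ∀ {D} r k → (∀ u → length (neighbours u) ≤ D) → length (reach r k) ≤ suc D ^ k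
    length-reach r zero small = ℕ.≤-refl
    length-reach {D} r (suc k) small =
      ℕ.≤-trans (length-concatMap (reach r k))
        (ℕ.≤-trans (ℕ.*-monoˡ-≤ (suc D) (length-reach r k small)) (ℕ.≤-reflexive (ℕ.*-comm (suc D ^ k) (suc D))))
      where
      length-concatMap : ∀ us → length (concatMap (λ u → u ∷ neighbours u) us) ≤ length us * suc D
      length-concatMap [] = z≤n
      length-concatMap (u ∷ us) = ℕ.≤-trans
        (ℕ.≤-reflexive (length-++ (u ∷ neighbours u)))
        (ℕ.+-mono-≤ (s≤s (small u)) (length-concatMap us))

    -- If `r` were comparable to everything, the vertices strictly below it and those strictly above
    -- it would be two modules omitting `r`. Among four vertices, two fall on the same side, so one
    -- of these modules is nontrivial.
    not-isolated : ∀ r → ¬ (∀ u → ¬ r ∥ u)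
    not-isolated r isolated with Fin.pigeonhole 3<size kind
      where
      kind : V → Fin 3
      kind u with compare u r
      ... | below _  = # 0
      ... | equal _  = # 1
      ... | above _  = # 2
      -- An arbitrary value: `isolated` excludes this case.
      ... | beside _ = # 1
    ... | i , j , i<j , eq with compare i r | compare j r
    ... | beside i∥r | _ = isolated i (∥-sym i∥r)
    ... | _ | beside j∥r = isolated j (∥-sym j∥r)
    ... | equal refl | equal refl = ℕ.<-irrefl refl i<j
    ... | below i⊏r | below j⊏r = ℕ.<⇒≢ i<j (cong toℕ (subsingleton
            (prime-dec prime {_⊏ r} (λ u → (rel P u r Bool.≟ true) ×-dec (rel P r u Bool.≟ false)) down) i⊏r j⊏r))
      where
      down : ∀ {v a a′} → ¬ v ⊏ r → a ⊏ r → a′ ⊏ r → (rel P v a ≡ rel P v a′) × (rel P a v ≡ rel P a′ v)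
      down {v} v⋢r a⊏r a′⊏r = trans (proj₂ (⊏v a⊏r)) (sym (proj₂ (⊏v a′⊏r))) , trans (proj₁ (⊏v a⊏r)) (sym (proj₁ (⊏v a′⊏r)))
        where
        ⊏v : ∀ {a} → a ⊏ r → a ⊏ v
        ⊏v a⊏r with compare v r
        ... | below v⊏r  = contradiction v⊏r v⋢r
        ... | equal refl = a⊏r
        ... | above r⊏v  = ⊏-trans a⊏r r⊏v
        ... | beside v∥r = contradiction (∥-sym v∥r) (isolated v)

      subsingleton : (∀ {x y} → x ⊏ r → y ⊏ r → x ≡ y) ⊎ (∀ x → x ⊏ r) → i ⊏ r → j ⊏ r → i ≡ j
      subsingleton (inj₁ sub) = sub
      subsingleton (inj₂ all) = contradiction (all r) ⊏-irrefl
    ... | above r⊏i | above r⊏j = ℕ.<⇒≢ i<j (cong toℕ (subsingleton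
            (prime-dec prime {r ⊏_} (λ u → (rel P r u Bool.≟ true) ×-dec (rel P u r Bool.≟ false)) up) r⊏i r⊏j))
      where
      up : ∀ {v a a′} → ¬ r ⊏ v → r ⊏ a → r ⊏ a′ → (rel P v a ≡ rel P v a′) × (rel P a v ≡ rel P a′ v)
      up {v} r⋢v r⊏a r⊏a′ = trans (proj₁ (v⊏ r⊏a)) (sym (proj₁ (v⊏ r⊏a′))) , trans (proj₂ (v⊏ r⊏a)) (sym (proj₂ (v⊏ r⊏a′)))
        where
        v⊏ : ∀ {a} → r ⊏ a → v ⊏ a
        v⊏ r⊏a with compare v r
        ... | below v⊏r  = ⊏-trans v⊏r r⊏a
        ... | equal refl = r⊏a
        ... | above r⊏v  = contradiction r⊏v r⋢v
        ... | beside v∥r = contradiction (∥-sym v∥r) (isolated v)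

      subsingleton : (∀ {x y} → r ⊏ x → r ⊏ y → x ≡ y) ⊎ (∀ x → r ⊏ x) → r ⊏ i → r ⊏ j → i ≡ j
      subsingleton (inj₁ sub) = sub
      subsingleton (inj₂ all) = contradiction (all r) ⊏-irrefl

    -- A connected component of the incomparability graph is a module.
    not-closed : ∀ {r k} → length (reach r k) < size P → ¬ (∀ {v} → v ∈ reach r (suc k) → v ∈ reach r k)
    not-closed {r} {k} small closed with prime-dec prime {_∈ reach r k} (_∈? reach r k) component-module
      where
      closed-∥ : ∀ {u v} → u ∈ reach r k → u ∥ v → v ∈ reach r k
      closed-∥ u∈ u∥v = closed (reach-∥ {k = k} u∈ u∥v)

      r∈reach : r ∈ reach r k
      r∈reach = reach-≤ {j = 0} {k} z≤n (here refl)

      -- Induction along a path from `r`. A vertex outside the component is comparable to all of it,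
      -- and changing sides between `u` and `a` would make these two comparable.
      uniform : ∀ {v} → v ∉ reach r k → ∀ j → j ≤ k → ∀ {a} → a ∈ reach r j →
        (v ⊏ r → v ⊏ a) × (r ⊏ v → a ⊏ v)
      uniform v∉ zero _ (here refl) = id , id
      uniform {v} v∉ (suc j) j<k {a} a∈ with reach-pred {k = j} a∈
      ... | u , u∈ , step with uniform v∉ j (ℕ.<⇒≤ j<k) u∈ | step
      ...   | ih | inj₁ refl = ih
      ...   | lower , upper | inj₂ u∥a with compare v a
      ...     | below v⊏a  = (λ _ → v⊏a) , λ r⊏v → contradiction (⊏-trans (upper r⊏v) v⊏a) (∥⇒¬⊏ u∥a)
      ...     | equal refl = contradiction (reach-≤ {j = suc j} j<k a∈) v∉
      ...     | above a⊏v  = (λ v⊏r → contradiction (⊏-trans a⊏v (lower v⊏r)) (∥⇒¬⊐ u∥a)) , λ _ → a⊏v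
      ...     | beside v∥a = contradiction (closed-∥ (reach-≤ {j = suc j} j<k a∈) (∥-sym v∥a)) v∉

      component-module : ∀ {v a a′} → v ∉ reach r k → a ∈ reach r k → a′ ∈ reach r k →
        (rel P v a ≡ rel P v a′) × (rel P a v ≡ rel P a′ v)
      component-module {v} v∉ a∈ a′∈ with compare v r
      ... | below v⊏r =
            let (p , q) = proj₁ (uniform v∉ k ℕ.≤-refl a∈) v⊏r
                (p′ , q′) = proj₁ (uniform v∉ k ℕ.≤-refl a′∈) v⊏r
            in trans p (sym p′) , trans q (sym q′)
      ... | equal refl = contradiction r∈reach v∉
      ... | above r⊏v =
            let (p , q) = proj₂ (uniform v∉ k ℕ.≤-refl a∈) r⊏v
                (p′ , q′) = proj₂ (uniform v∉ k ℕ.≤-refl a′∈) r⊏v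
            in trans q (sym q′) , trans p (sym p′)
      ... | beside v∥r = contradiction (closed-∥ r∈reach (∥-sym v∥r)) v∉
    ... | inj₁ sub = not-isolated r λ u r∥u →
          ∥-irrefl (subst (r ∥_) (sub (closed (reach-∥ {k = k} r∈ r∥u)) r∈) r∥u)
      where
      r∈ : r ∈ reach r k
      r∈ = reach-≤ {j = 0} {k} z≤n (here refl)
    ... | inj₂ all = contradiction (covering⇒size≤ (reach r k) all) (ℕ.<⇒≱ small)

    -- Geodesics and the path order

    Layer : V → ℕ → V → Set
    Layer r zero    u = u ∈ reach r zero
    Layer r (suc k) u = u ∈ reach r (suc k) × u ∉ reach r k

    layer-reach : ∀ {r} k {u} → Layer r k u → u ∈ reach r k
    layer-reach zero    u∈       = u∈
    layer-reach (suc k) (u∈ , _) = u∈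

    -- Numbered from the far end towards `r`, so that the recursion in `geodesic` only prepends a
    -- vertex.
    Geodesic : V → ℕ → (ℕ → V) → Set
    Geodesic r k y = (∀ i → i ≤ k → Layer r (k ∸ i) (y i)) × (∀ i → i < k → y i ∥ y (suc i))

    geodesic : ∀ {r} k {v} → Layer r k v → ∃ λ y → y 0 ≡ v × Geodesic r k y
    geodesic zero {v} layer = (λ _ → v) , refl , (λ { _ z≤n → layer }) , λ _ ()
    geodesic {r} (suc k) {v} (v∈ , v∉) with reach-pred {k = k} v∈
    ... | u , u∈ , inj₁ refl = contradiction u∈ v∉
    ... | u , u∈ , inj₂ u∥v with geodesic k {u} (layer k u∈ v∉)
      where
      layer : ∀ k → u ∈ reach r k → v ∉ reach r k → Layer r k u
      layer zero    u∈ _  = u∈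
      layer (suc k) u∈ v∉ = u∈ , λ u∈′ → v∉ (reach-∥ {k = k} u∈′ u∥v)
    ... | y , y₀ , layers , edges = y′ , refl , layers′ , edges′
      where
      y′ : ℕ → V
      y′ zero    = v
      y′ (suc i) = y i

      layers′ : ∀ i → i ≤ suc k → Layer r (suc k ∸ i) (y′ i)
      layers′ zero    _         = v∈ , v∉
      layers′ (suc i) (s≤s i≤k) = layers i i≤k

      edges′ : ∀ i → i < suc k → y′ i ∥ y′ (suc i)
      edges′ zero    _         = subst (v ∥_) (sym y₀) (∥-sym u∥v)
      edges′ (suc i) (s≤s i<k) = edges i i<k

    module _ {r K y} (geo : Geodesic r K y) where
      layers = proj₁ geo
      edges  = proj₂ geo

      -- The distances of the two vertices from `r` differ by at least two, so the vertices are
      -- neither equal nor incomparable.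
      geodesic-far : ∀ {i j} → suc i < j → j ≤ K → Comparable (y i) (y j)
      geodesic-far {i} {j} i+1<j j≤K =
        apart (K ∸ i) (∸-gap i+1<j j≤K)
          (layers i (ℕ.≤-trans (ℕ.<⇒≤ (ℕ.<-trans (ℕ.n<1+n i) i+1<j)) j≤K)) (layer-reach (K ∸ j) (layers j j≤K))
        where
        apart : ∀ p {q x z} → suc q < p → Layer r p x → z ∈ reach r q → Comparable x z
        apart (suc p) {q} {x} {z} (s≤s q<p) (_ , x∉) z∈ with compare x z
        ... | below x⊏z  = inj₁ x⊏z
        ... | equal refl = contradiction (reach-≤ (ℕ.<⇒≤ q<p) z∈) x∉
        ... | above z⊏x  = inj₂ z⊏x
        ... | beside x∥z = contradiction (reach-≤ q<p (reach-∥ {k = q} z∈ (∥-sym x∥z))) x∉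

      -- The direction of the first pair propagates: any later reversal would, by transitivity, make
      -- two consecutive vertices comparable. The relation is abstract because a descending geodesic
      -- uses `flip _⊏_`.
      ascending : ∀ (_◁_ : V → V → Set) → (∀ {a b c} → a ◁ b → b ◁ c → a ◁ c) → (∀ {a b} → a ∥ b → ¬ a ◁ b) →
        (∀ {i j} → suc i < j → j ≤ K → y i ◁ y j ⊎ y j ◁ y i) → y 0 ◁ y 2 →
        ∀ {i j} → suc i < j → j ≤ K → y i ◁ y j
      ascending _◁_ ◁-trans ∥⇒¬◁ far y₀◁y₂ {i} {j} i+1<j j≤K =
        row (ℕ.≤⇒≤′ i+1<j) j≤K
        where
        extend-right : ∀ {i j} → suc i < j → suc j ≤ K → y i ◁ y j → y i ◁ y (suc j)
        extend-right {i} {j} gap j<K i◁j with far (ℕ.m<n⇒m<1+n gap) j<K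
        ... | inj₁ ◁ = ◁
        ... | inj₂ ▷ = contradiction (◁-trans ▷ i◁j) (∥⇒¬◁ (∥-sym (edges j j<K)))

        diagonal : ∀ i → suc (suc i) ≤ K → y i ◁ y (suc (suc i))
        diagonal zero    _ = y₀◁y₂
        diagonal (suc i) i+3≤K with far {suc i} {suc (suc (suc i))} ℕ.≤-refl i+3≤K
        ... | inj₁ ◁ = ◁
        -- From `y i ◁ y (i + 2)` one gets `y i ◁ y (i + 3)`; with `y (i + 3) ◁ y (i + 1)` this
        -- would compare `y i` to its successor.
        ... | inj₂ ▷ = contradiction
              (◁-trans (extend-right ℕ.≤-refl i+3≤K (diagonal i (ℕ.<⇒≤ i+3≤K))) ▷)
              (∥⇒¬◁ (edges i (ℕ.<⇒≤ (ℕ.<⇒≤ i+3≤K))))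

        row : ∀ {j} → suc (suc i) ≤′ j → j ≤ K → y i ◁ y j
        row ≤′-refl        j≤K = diagonal i j≤K
        row (≤′-step gap) j≤K = extend-right (ℕ.≤′⇒≤ gap) j≤K (row gap (ℕ.<⇒≤ j≤K))

    path-embedding : ∀ {N} (z : ℕ → V) → (∀ i → i < 3 + N → z i ∥ z (suc i)) →
      (∀ {i j} → suc i < j → j ≤ 3 + N → z i ⊏ z j) → Embeds (pathPosets N) P
    path-embedding {N} z near far = embed-increasing pathOrder-natural (z ∘ toℕ) comparable incomparable
      where
      comparable : ∀ {s t : Fin (4 + N)} → toℕ s < toℕ t → pathOrder (toℕ s) (toℕ t) ≡ true → z (toℕ s) ⊏ z (toℕ t)
      comparable {s} {t} s<t eq with ℕ.m≤n⇒m<n∨m≡n s<t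
      ... | inj₁ gap  = far gap (ℕ.≤-pred (Fin.toℕ<n t))
      ... | inj₂ next = contradiction
            (trans (sym eq) (trans (cong (pathOrder (toℕ s)) (sym next)) (pathOrder-near (toℕ s)))) λ ()

      incomparable : ∀ {s t : Fin (4 + N)} → toℕ s < toℕ t → pathOrder (toℕ s) (toℕ t) ≡ false → z (toℕ s) ∥ z (toℕ t)
      incomparable {s} {t} s<t eq with ℕ.m≤n⇒m<n∨m≡n s<t
      ... | inj₁ gap  = contradiction (trans (sym eq) (pathOrder-far gap)) λ ()
      ... | inj₂ next = subst (λ k → z (toℕ s) ∥ z k) next
            (near (toℕ s) (ℕ.≤-pred (subst (_< 4 + N) (sym next) (Fin.toℕ<n t))))

    geodesic⇒path : ∀ {N r y} → Geodesic r (3 + N) y → Embeds (pathPosets N) P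
    geodesic⇒path {N} {r} {y} geo@(_ , edges) with geodesic-far geo {0} {2} ℕ.≤-refl (s≤s (s≤s z≤n))
    ... | inj₁ y₀⊏y₂ = path-embedding y edges
          (ascending geo _⊏_ ⊏-trans ∥⇒¬⊏ (geodesic-far geo) y₀⊏y₂)
    -- A descending geodesic is read from its other end.
    ... | inj₂ y₂⊏y₀ = path-embedding (λ i → y (3 + N ∸ i))
          (λ i i<K → subst (λ k → y k ∥ y (2 + N ∸ i)) (sym (ℕ.+-∸-assoc 1 (ℕ.≤-pred i<K)))
             (∥-sym (edges (2 + N ∸ i) (s≤s (ℕ.m∸n≤m (2 + N) i)))))
          (λ {i} {j} i+1<j j≤K → ascending geo (flip _⊏_) (flip ⊏-trans) ∥⇒¬⊐
             (λ gap ≤K → Sum.swap (geodesic-far geo gap ≤K)) y₂⊏y₀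
             (∸-gap i+1<j j≤K) (ℕ.m∸n≤m (3 + N) i))

    -- If all degrees are at most `N + N`, the ball of radius `2 + N` has at most
    -- `suc (N + N) ^ (2 + N)` elements and is not everything. By `not-closed` some vertex is then
    -- at distance `3 + N` from the root, and its geodesic has the `4 + N` vertices of
    -- `pathPosets N`.
    half-or-path : ∀ N → suc (N + N) ^ (2 + N) < size P → Embeds (halfPosets N) P ⊎ Embeds (pathPosets N) P
    half-or-path N large with Fin.any? (λ v → N + N ℕ.<? length (neighbours v))
    ... | yes (v , many) = inj₁ (HighDegree.half-in-neighbourhood v many)
    ... | no few with Fin.any? (λ v → (v ∈? reach root (3 + N)) ×-dec ¬? (v ∈? reach root (2 + N)))
      where
      root : V
      root = fromℕ< large
    ...   | yes (v , layer) = inj₂ (geodesic⇒path (proj₂ (proj₂ (geodesic (3 + N) layer))))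
    ...   | no closed = contradiction
            (λ {v} v∈ → decidable-stable (v ∈? reach (fromℕ< large) (2 + N)) λ v∉ → closed (v , v∈ , v∉))
            (not-closed {k = 2 + N} (ℕ.≤-<-trans
              (length-reach (fromℕ< large) (2 + N) λ v → ℕ.≮⇒≥ λ many → few (v , many)) large))

-- Unavoidability and the classification

halfPoset-or-path : Unavoidable (λ P → IsPoset P × Width≤2 P) halfPosets pathPosets
-- The summand `4` secures `3 < size P` and makes the bound of `half-or-path` strict.
halfPoset-or-path N = 4 + suc (N + N) ^ (2 + N) , λ P (poset , width) prime M≤size →
  Poset.PrimeWidth2.half-or-path poset width prime (ℕ.≤-trans (ℕ.m≤m+n 4 _) M≤size) N
    (ℕ.≤-trans (ℕ.m≤n+m _ 3) M≤size)

halfGraph-or-path : Unavoidable (λ G → IsGraph G × IsIncompGraphW2 G) halfGraphs pathGraphs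
halfGraph-or-path N = let M , forced = halfPoset-or-path N in M , λ G (_ , r , poset , width , inc-r) prime M≤size →
  let P      = mkStr (size G) r
      primeP = inc-prime⇒prime {P} (prime-resp inc-r prime)
      P→G    = Embeds-pointwise λ i j → sym (inc-r i j)
  in Sum.map
    (λ half≤P → Embeds-trans (halfGraphs N) (inc (halfPosets N)) G
       (Embeds-pointwise λ i j → sym (inc-P₁ (double N) i j))
       (Embeds-trans (inc (halfPosets N)) (inc P) G (inc-mono {halfPosets N} {P} half≤P) P→G))
    (λ path≤P → Embeds-trans (pathGraphs N) (inc (pathPosets N)) G
       (Embeds-pointwise λ i j → sym (inc-path (4 + N) i j))
       (Embeds-trans (inc (pathPosets N)) (inc P) G (inc-mono {pathPosets N} {P} path≤P) P→G))
    (forced P (poset , width) primeP M≤size)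

≐-dichotomy : ∀ {C A B A′ B′ : Class} → A ≐ A′ → B ≐ B′ →
  MinimalPrime C ⇔₁ ((C ≐ A) ⊎ (C ≐ B)) → MinimalPrime C ⇔₁ ((C ≐ A′) ⊎ (C ≐ B′))
≐-dichotomy {C} {A} {B} {A′} {B′} A≐A′ B≐B′ (forth , back) =
  (λ min → Sum.map (λ e → ≐-trans {C} {A} {A′} e A≐A′) (λ e → ≐-trans {C} {B} {B′} e B≐B′) (forth min)) ,
  (λ e → back (Sum.map (λ e → ≐-trans {C} {A′} {A} e (≐-sym {A} {A′} A≐A′))
                       (λ e → ≐-trans {C} {B′} {B} e (≐-sym {B} {B′} B≐B′)) e))

mainTheorem7 : (∀ (C : Class) → Hereditary C → PosetsW2 C →
    MinimalPrime C ⇔₁ ((C ≐ Age P₁) ⊎ (C ≐ Age P₂)))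
    ×
    (∀ (C : Class) → Hereditary C → GraphsIncW2 C →
    MinimalPrime C ⇔₁ ((C ≐ Age H) ⊎ (C ≐ Age P∞)))
mainTheorem7 =
  (λ C her C⊆K → ≐-dichotomy {C} {Below halfPosets} {Below pathPosets} {Age P₁} {Age P₂}
    (≐-sym {Age P₁} (age≐below P₁ double n≤double))
    (≐-sym {Age P₂} (≐-trans {Age P₂} {Age pathOrder} ageP₂≐age-pathOrder
      (age≐below pathOrder (4 +_) λ n → ℕ.m≤n+m n 4)))
    (dichotomy halfPoset-family pathPoset-family halfPoset-or-path halfPoset⊀path pathPoset⊀half C her C⊆K)) ,
  (λ C her C⊆K → ≐-dichotomy {C} {Below halfGraphs} {Below pathGraphs} {Age H} {Age P∞}
    (≐-sym {Age H} (≐-trans {Age H} {Age half} ageH≐age-half (age≐below half double n≤double)))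
    (≐-sym {Age P∞} (age≐below P∞ (4 +_) λ n → ℕ.m≤n+m n 4))
    (dichotomy halfGraph-family pathGraph-family halfGraph-or-path half⊀path path⊀half C her C⊆K))
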